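{- Let $\Sigma$ be a finite ranked set. If a language $L\subseteq\mathsf{H}_0\Sigma$ is definable in counting $\mathrm{MSO}_2$, then it is recognised by a computable $\mathsf{H}$-algebra that is finite on every arity.
   Context: Ranked sets have arities in $\{0,1,\dots\}$. $\mathsf{H}\Sigma$: finite sourced hypergraphs over $\Sigma$ modulo isomorphism (finite vertex set; finite ranked set of hyperedges, each $n$-ary hyperedge $e$ with a non-repeating incidence list $e[1..n]$; arity-preserving labelling by $\Sigma$; for arity $n$ an injective source function $\{1..n\}\to$ vertices); $\mathsf{H}_0\Sigma$: nullary ones. Unit of $n$-ary $a$: single hyperedge labelled $a$ on vertices $1..n$, identity sources. Flattening of $G\in\mathsf H\mathsf H\Sigma$: hyperedges $(e,f)$, $f$ a hyperedge of the label of $e$; vertices those of $G$ plus $(e,v)$ for non-source $v$ of the label of $e$; sources of $G$; incidence of $(e,f)$ from $f$ with $v\mapsto(e,v)$ for non-sources and $v\mapsto e[i]$ for the $i$-th source. An $\mathsf H$-algebra is an arity-preserving $\pi:\mathsf HA\to A$ with $\pi\circ\mathrm{unit}=\mathrm{id}$, $\pi\circ\mathrm{flatten}=\pi\circ\mathsf H\pi$; it recognises $L$ if some homomorphism $h:\mathsf H\Sigma\to A$ (commuting with products) determines membership in $L$. An $\mathsf H$-algebra is computable if its elements can be represented finitely (e.g.\ as strings) so that there are algorithms which (1) given an arity $n$ and $i\ge 1$ compute the $i$-th $n$-ary element or report that there are fewer than $i$; (2) given an element of $\mathsf HA$ compute its product $\pi$. Counting $\mathrm{MSO}_2$: MSO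 with predicates $|X|\equiv k\bmod m$ over the model with universe vertices $\sqcup$ hyperedges, a unary relation per label and binary relations $\{(e,v):e[i]=v\}$. -}

module Defs where

open import Level using (Level) renaming (zero to 0ℓ)
open import Data.Nat using (ℕ; zero; suc; _+_; _%_; _≡ᵇ_)
open import Data.Nat.Properties using (+-assoc)
open import Data.Bool using (Bool; true; false; if_then_else_; _∧_; not; _∨_)
open import Data.Fin as Fin using (Fin; _↑ˡ_; _↑ʳ_; splitAt)
open import Data.Sum using (_⊎_; inj₁; inj₂; [_,_])
open import Data.Product using (Σ; _,_; proj₁; proj₂; Σ-syntax)
open import Data.List as List using (List; []; _∷_; _++_; length)
open import Data.List.Relation.Unary.All using (All)
open import Data.List.Relation.Binary.Permutation.Propositional using (_↭_)
open import Data.Vec as Vec using (Vec; []; _∷_)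
open import Function using (_∘_)
open import Function.Bundles using (_↔_; Inverse)
open import Relation.Binary.PropositionalEquality using (_≡_)
open import Relation.Nullary.Decidable using (⌊_⌋)
open import Data.Bool.ListAction renaming (any to anyL)

Ranked : Set₁
Ranked = ℕ → Set

record FinRanked : Set where
  field
    size  : ℕ
    arity : Fin size → ℕ

⟦_⟧ : FinRanked → Ranked
⟦ Σ' ⟧ n = Σ[ a ∈ Fin (FinRanked.size Σ') ] FinRanked.arity Σ' a ≡ n

-- Sourced hypergraphs (raw representatives)
--
-- A hypergraph of arity n has vertex set Fin (n + inner):  the first n
-- vertices are the sources, in order (source i is  i ↑ˡ inner), the
-- remaining `inner` vertices are the non-source vertices.  Every sourced
-- hypergraph (injective source function) is isomorphic to one of this
-- form.  Hyperedges form a finite list; each hyperedge carries its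
-- arity, its label (of that arity) and its incidence list.

record Edge (R : Ranked) (V : ℕ) : Set where
  constructor edge
  field
    ar  : ℕ
    lab : R ar
    inc : Vec (Fin V) ar

record Hyp (R : Ranked) (n : ℕ) : Set where
  constructor hyp
  field
    inner : ℕ
    edges : List (Edge R (n + inner))

open Edge
open Hyp

NonRep : ∀ {V a} → Vec (Fin V) a → Set
NonRep v = ∀ i j → Vec.lookup v i ≡ Vec.lookup v j → i ≡ j

WF : ∀ {R n} → Hyp R n → Set
WF G = All (λ e → NonRep (inc e)) (edges G)

WF² : ∀ {R n} → Hyp (λ m → Hyp R m) n → Set
WF² G = WF G × All (λ e → WF (lab e)) (edges G)
  where open import Data.Product using (_×_)

renE : ∀ {R V W} → (Fin V → Fin W) → Edge R V → Edge R W
renE f (edge a l v) = edge a l (Vec.map f v)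

mapE : ∀ {R R' V} → (∀ {a} → R a → R' a) → Edge R V → Edge R' V
mapE f (edge a l v) = edge a (f l) v

mapH : ∀ {R R' n} → (∀ {a} → R a → R' a) → Hyp R n → Hyp R' n
mapH f (hyp k es) = hyp k (List.map (mapE f) es)

record Iso {R : Ranked} {n : ℕ} (G G' : Hyp R n) : Set where
  field
    bij : Fin (n + inner G) ↔ Fin (n + inner G')
    src : ∀ i → Inverse.to bij (i ↑ˡ inner G) ≡ i ↑ˡ inner G'
    edg : List.map (renE (Inverse.to bij)) (edges G) ↭ edges G'

unit : ∀ {R n} → R n → Hyp R n
unit {n = n} a = hyp 0 (edge n a (Vec.tabulate (λ i → i ↑ˡ 0)) ∷ [])

innerSum : ∀ {R W} → List (Edge (λ m → Hyp R m) W) → ℕ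
innerSum []       = 0
innerSum (e ∷ es) = inner (lab e) + innerSum es

flattenEdges : ∀ {R W V} (es : List (Edge (λ m → Hyp R m) W)) →
               (Fin W → Fin V) → (Fin (innerSum es) → Fin V) → List (Edge R V)
flattenEdges []                    out emb = []
flattenEdges (edge a H v ∷ es) out emb =
  List.map (renE ρ) (edges H) ++ flattenEdges es out (emb ∘ (inner H ↑ʳ_))
  where
  ρ : Fin (a + inner H) → Fin _
  ρ x = [ (λ i → out (Vec.lookup v i)) , (λ j → emb (j ↑ˡ innerSum es)) ] (splitAt a x)

flatten : ∀ {R n} → Hyp (λ m → Hyp R m) n → Hyp R n
flatten {n = n} (hyp k es) =
  hyp (k + innerSum es)
      (flattenEdges es (λ x → Fin.cast (+-assoc n k T) (x ↑ˡ T))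
                       (λ j → Fin.cast (+-assoc n k T) ((n + k) ↑ʳ j)))
  where T = innerSum es

-- Computable H-algebras that are finite on every arity
--
-- The n-ary elements are Fin (size n); size and the product are Agda
-- functions, hence computable (enumeration of the i-th n-ary element is
-- given by Fin (size n); the product is the function π).

record CompFinHAlgebra : Set where
  field
    size : ℕ → ℕ
    π    : ∀ {n} → Hyp (Fin ∘ size) n → Fin (size n)
    π-iso   : ∀ {n} (G G' : Hyp (Fin ∘ size) n) → WF G → WF G' → Iso G G' → π G ≡ π G'
    π-unit  : ∀ {n} (a : Fin (size n)) → π (unit a) ≡ a
    π-assoc : ∀ {n} (G : Hyp (λ m → Hyp (Fin ∘ size) m) n) → WF² G →
              π (flatten G) ≡ π (mapH π G)

Carrier : CompFinHAlgebra → Ranked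
Carrier A = Fin ∘ CompFinHAlgebra.size A

record Hom (Σ' : FinRanked) (A : CompFinHAlgebra) : Set where
  open CompFinHAlgebra A
  field
    h       : ∀ {n} → Hyp ⟦ Σ' ⟧ n → Fin (size n)
    h-iso   : ∀ {n} (G G' : Hyp ⟦ Σ' ⟧ n) → WF G → WF G' → Iso G G' → h G ≡ h G'
    h-mult  : ∀ {n} (G : Hyp (λ m → Hyp ⟦ Σ' ⟧ m) n) → WF² G →
              h (flatten G) ≡ π (mapH h G)

Recognises : ∀ {Σ' A} → Hom Σ' A → (Hyp ⟦ Σ' ⟧ 0 → Set) → Set
Recognises {Σ'} φ L =
  ∀ (G G' : Hyp ⟦ Σ' ⟧ 0) → WF G → WF G' → Hom.h φ G ≡ Hom.h φ G' → L G → L G'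

-- Counting MSO₂
--
-- First-order variables (de Bruijn, Fin fo) range over vertices and
-- hyperedges; set variables (Fin so) over sets of those.

data Form (Σ' : FinRanked) (fo so : ℕ) : Set where
  lab?  : Fin (FinRanked.size Σ') → Fin fo → Form Σ' fo so
  inc?  : ℕ → Fin fo → Fin fo → Form Σ' fo so                 -- x is a hyperedge e and e[i] = y  (i ≥ 1)
  eq?   : Fin fo → Fin fo → Form Σ' fo so
  mem?  : Fin fo → Fin so → Form Σ' fo so
  card? : Fin so → ℕ → ℕ → Form Σ' fo so                      -- |X| ≡ k mod m
  ¬'    : Form Σ' fo so → Form Σ' fo so
  _∧'_  : Form Σ' fo so → Form Σ' fo so → Form Σ' fo so
  ∃₁    : Form Σ' (suc fo) so → Form Σ' fo so
  ∃₂    : Form Σ' fo (suc so) → Form Σ' fo so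

-- a ≡ b (mod m); for m = 0 this is a = b
modEq : ℕ → ℕ → ℕ → Bool
modEq zero    a b = a ≡ᵇ b
modEq (suc m) a b = (a % suc m) ≡ᵇ (b % suc m)

count : ∀ {N} → (Fin N → Bool) → ℕ
count {zero}  X = 0
count {suc N} X = (if X Fin.zero then 1 else 0) + count (X ∘ Fin.suc)

anyFin : ∀ {N} → (Fin N → Bool) → Bool
anyFin {zero}  p = false
anyFin {suc N} p = p Fin.zero ∨ anyFin (p ∘ Fin.suc)

subsets : (N : ℕ) → List (Fin N → Bool)
subsets zero    = (λ ()) ∷ []
subsets (suc N) = List.concatMap (λ X → cons false X ∷ cons true X ∷ []) (subsets N)
  where
  cons : Bool → (Fin N → Bool) → Fin (suc N) → Bool
  cons b X Fin.zero    = b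
  cons b X (Fin.suc i) = X i

-- e[i] = v with 1-based position i
incAt : ∀ {V a} → ℕ → Vec (Fin V) a → Fin V → Bool
incAt i               []       v = false
incAt zero            (w ∷ ws) v = false
incAt (suc zero)      (w ∷ ws) v = ⌊ w Fin.≟ v ⌋
incAt (suc (suc i))   (w ∷ ws) v = incAt (suc i) ws v

module _ {Σ' : FinRanked} (G : Hyp ⟦ Σ' ⟧ 0) where
  V = inner G
  E = length (edges G)
  N = V + E

  edgeAt : Fin E → Edge ⟦ Σ' ⟧ (0 + V)
  edgeAt = List.lookup (edges G)

  labAt : Fin (FinRanked.size Σ') → Fin N → Bool
  labAt a x = [ (λ _ → false) , (λ e → ⌊ proj₁ (lab (edgeAt e)) Fin.≟ a ⌋) ] (splitAt V x)

  incRel : ℕ → Fin N → Fin N → Bool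
  incRel i x y with splitAt V x | splitAt V y
  ... | inj₂ e | inj₁ v = incAt i (inc (edgeAt e)) v
  ... | _      | _      = false

  eval : ∀ {fo so} → Form Σ' fo so → (Fin fo → Fin N) → (Fin so → Fin N → Bool) → Bool
  eval (lab? a x)     ρ σ = labAt a (ρ x)
  eval (inc? i x y)   ρ σ = incRel i (ρ x) (ρ y)
  eval (eq? x y)      ρ σ = ⌊ ρ x Fin.≟ ρ y ⌋
  eval (mem? x X)     ρ σ = σ X (ρ x)
  eval (card? X k m)  ρ σ = modEq m (count (σ X)) k
  eval (¬' φ)         ρ σ = not (eval φ ρ σ)
  eval (φ ∧' ψ)       ρ σ = eval φ ρ σ ∧ eval ψ ρ σ
  eval (∃₁ φ)         ρ σ = anyFin (λ x → eval φ (λ { Fin.zero → x ; (Fin.suc i) → ρ i }) σ)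
  eval (∃₂ φ)         ρ σ = anyL (λ X → eval φ ρ (λ { Fin.zero → X ; (Fin.suc i) → σ i })) (subsets N)

  _⊨_ : Form Σ' 0 0 → Set
  _⊨_ φ = eval φ (λ ()) (λ ()) ≡ true

CMSO₂-definable : (Σ' : FinRanked) → (Hyp ⟦ Σ' ⟧ 0 → Set) → Set
CMSO₂-definable Σ' L = Σ[ φ ∈ Form Σ' 0 0 ] (∀ G → WF G → (L G → G ⊨ φ) × (G ⊨ φ → L G))
  where open import Data.Product using (_×_)

{-# OPTIONS --safe #-}
module Submission where

-- Each formula is recognised by induction on its structure.  Colour every vertex and hyperedge by
-- the values of the characteristic functions of the free variables there, first-order variables
-- being singletons, and recognise coloured hypergraphs.  Adding a unary hyperedge at every
-- internal vertex lets a colouring of vertices become a colouring of hyperedges, so only labels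
-- carry colours: then an existential quantifier is a relabelling, hence handled by the powerset
-- algebra (a product of sets is the set of products of all choices of one element per hyperedge).
-- Conjunctions use product algebras, and the atomic formulas, apart from incidence, are all
-- statements about the number of hyperedges with given labels, which a finite quotient of (ℕ, +)
-- keeps track of.  Incidence needs an algebra that remembers which sources have been pinned by the
-- i-th place of x and by y.  The marking of internal vertices is undone at the end by building it
-- into the product operation.

open import Defs
open import Algebra.Bundles using (CommutativeMonoid)
open import Algebra.Properties.CommutativeSemigroup using (interchange)
open import Data.Bool as Bool using (Bool; true; false; not; _∧_; _∨_; if_then_else_)
open import Data.Bool.ListAction using (any)
open import Data.Bool.Properties as BoolP using (T-≡; ∨-zeroʳ)
open import Data.Fin as Fin using (Fin; zero; suc; toℕ; fromℕ<; _↑ˡ_; _↑ʳ_; splitAt; cast)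
open import Data.Fin.Properties as FinP using
  ( toℕ-injective; toℕ-cast; toℕ-↑ˡ; toℕ-↑ʳ; toℕ-fromℕ<; toℕ<n; ↑ˡ-injective; ↑ʳ-injective
  ; splitAt-↑ˡ; splitAt-↑ʳ; splitAt⁻¹-↑ˡ; splitAt⁻¹-↑ʳ; *↔×; 2↔Bool )
open import Data.Fin.Subset using (Subset; ⁅_⁆; _∪_) renaming (_∈_ to _∈ₛ_)
open import Data.Fin.Subset.Properties using
  (_∈?_; ⊆-antisym; x∈p∪q⁺; x∈p∪q⁻; x∈⁅x⁆; x∈⁅y⁆⇒x≡y)
open import Data.List as List using (List; []; _∷_; _++_; length; tabulate; cartesianProductWith)
import Data.List.Properties as ListP
open import Data.List.Membership.Propositional using (_∈_; find; lose)
open import Data.List.Membership.Propositional.Properties using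
  ( ∈-tabulate⁺; ∈-tabulate⁻; ∈-map⁺; ∈-map⁻; ∈-filter⁺; ∈-filter⁻; ∈-allFin
  ; ∈-cartesianProductWith⁺; ∈-cartesianProductWith⁻ )
open import Data.List.Membership.Propositional.Properties.WithK using (unique∧set⇒bag)
open import Data.List.Relation.Binary.BagAndSetEquality using (∼bag⇒↭)
open import Data.List.Relation.Binary.Permutation.Propositional as Perm using
  (_↭_; ↭-sym; ↭-trans; ↭-reflexive; ↭-refl)
import Data.List.Relation.Binary.Permutation.Propositional.Properties as PermP
open import Data.List.Relation.Binary.Pointwise as Pointwise using (Pointwise; []; _∷_)
open import Data.List.Relation.Unary.Any as Any using (Any; here; there)
import Data.List.Relation.Unary.Any.Properties as AnyP
import Data.List.Relation.Unary.Unique.Propositional.Properties as Unique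
open import Data.Nat using (ℕ; zero; suc; _+_; _*_; _%_; _⊓_; _≡ᵇ_; s≤s; s≤s⁻¹)
open import Data.Nat.DivMod using (_mod_; %-distribˡ-+; m%n%n≡m%n; m<n⇒m%n≡m)
open import Data.Nat.ListAction using (sum)
open import Data.Nat.ListAction.Properties using (sum-↭; sum-++)
open import Data.Nat.Properties using
  ( +-assoc; +-comm; suc-injective; ≤-total; ≤-trans; m≤m+n; m⊓n≤n; m≤n⇒m⊓n≡m; m≥n⇒m⊓n≡n
  ; ≡⇒≡ᵇ; ≡ᵇ⇒≡ )
open import Data.Product using (Σ-syntax; ∃; _×_; _,_; proj₁; proj₂)
open import Data.Product.Function.NonDependent.Propositional using (_×-↔_)
open import Data.Sum using (_⊎_; inj₁; inj₂; [_,_])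
open import Data.Vec as Vec using (Vec; []; _∷_)
import Data.Vec.Properties as VecP
open import Function using (_∘_; id; _⇔_; mk⇔; mk↔ₛ′; Equivalence)
open import Function.Bundles using (_↔_; Inverse)
open import Function.Properties.Inverse using (↔-sym; ↔-trans; ↔-refl)
open import Relation.Binary.PropositionalEquality using
  (_≡_; _≢_; _≗_; refl; sym; trans; cong; cong₂; subst; module ≡-Reasoning)
open import Relation.Nullary using (Dec; yes; does; contradiction)
open import Relation.Nullary.Decidable using (⌊_⌋; dec-true; isYes≗does; _×-dec_; _⊎-dec_)

open Edge
open Hyp
open ≡-Reasoning

-- Renaming vertices and relabelling hyperedges

renE-cong : ∀ {R V W} {f g : Fin V → Fin W} → f ≗ g → renE {R} f ≗ renE g
renE-cong f≗g (edge a l v) = cong (edge a l) (VecP.map-cong f≗g v)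

renE-id : ∀ {R V} {f : Fin V → Fin V} → (∀ x → f x ≡ x) → ∀ e → renE {R} f e ≡ e
renE-id f≗id (edge a l v) = cong (edge a l) (trans (VecP.map-cong f≗id v) (VecP.map-id v))

renE-∘ : ∀ {R U V W} (g : Fin V → Fin W) (f : Fin U → Fin V) (e : Edge R U) →
  renE (g ∘ f) e ≡ renE g (renE f e)
renE-∘ g f (edge a l v) = cong (edge a l) (VecP.map-∘ g f v)

mapH-cong : ∀ {R R' : Ranked} {n} {f g : ∀ {a} → R a → R' a} →
  (∀ {a} (x : R a) → f x ≡ g x) → (G : Hyp R n) → mapH f G ≡ mapH g G
mapH-cong f≗g (hyp k es) =
  cong (hyp k) (ListP.map-cong (λ { (edge a l v) → cong (λ l' → edge a l' v) (f≗g l) }) es)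

mapH-∘ : ∀ {R R' R'' : Ranked} {n} (g : ∀ {a} → R' a → R'' a) (f : ∀ {a} → R a → R' a) →
  (G : Hyp R n) → mapH (λ x → g (f x)) G ≡ mapH g (mapH f G)
mapH-∘ g f (hyp k es) = cong (hyp k) (ListP.map-∘ es)

-- Hypergraph isomorphisms

module _ {R : Ranked} {n : ℕ} where

  Iso-sym : {G G' : Hyp R n} → Iso G G' → Iso G' G
  Iso-sym {hyp k es} {hyp k' es'} i = record
    { bij = ↔-sym bij
    ; src = λ j → trans (cong from (sym (src j))) (strictlyInverseʳ _)
    ; edg = ↭-trans (PermP.map⁺ (renE from) (↭-sym edg)) (↭-reflexive
        (trans (sym (ListP.map-∘ es))
        (trans (ListP.map-cong (λ e → trans (sym (renE-∘ from to e)) (renE-id strictlyInverseʳ e)) es)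
               (ListP.map-id es))))
    }
    where
    open Iso i
    open Inverse bij

  ↭⇒Iso : ∀ {k} {es es' : List (Edge R (n + k))} → es ↭ es' → Iso (hyp k es) (hyp k es')
  ↭⇒Iso {k} {es} p = record
    { bij = mk↔ₛ′ id id (λ _ → refl) (λ _ → refl)
    ; src = λ _ → refl
    ; edg = ↭-trans (↭-reflexive (trans (ListP.map-cong (renE-id λ _ → refl) es) (ListP.map-id es))) p
    }

module _ {R R' : Ranked} {n : ℕ} (f : ∀ {a} → R a → R' a) where

  mapH-Iso : {G G' : Hyp R n} → Iso G G' → Iso (mapH f G) (mapH f G')
  mapH-Iso {hyp k es} {hyp k' es'} i = record
    { bij = bij
    ; src = src
    ; edg = ↭-trans (↭-reflexive (trans (sym (ListP.map-∘ es)) (ListP.map-∘ es))) (PermP.map⁺ (mapE f) edg)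
    }
    where open Iso i

module _ {R : Ranked} {n : ℕ} {G G' : Hyp R n} (i : Iso G G') where
  open Iso i
  open Inverse bij

  Iso-injective : ∀ {x y} → to x ≡ to y → x ≡ y
  Iso-injective {x} {y} eq = trans (sym (strictlyInverseʳ x)) (trans (cong from eq) (strictlyInverseʳ y))

  -- Sources already go to sources and the bijection is injective, so an internal vertex cannot land
  -- on a source.
  Iso-inner : (j : Fin (inner G)) → ∃ λ j' → to (n ↑ʳ j) ≡ n ↑ʳ j'
  Iso-inner j with splitAt n (to (n ↑ʳ j)) in eq
  ... | inj₂ j' = j' , sym (splitAt⁻¹-↑ʳ eq)
  ... | inj₁ s  = contradiction
    (trans (sym (splitAt-↑ˡ n s (inner G)))
    (trans (cong (splitAt n) (Iso-injective (trans (src s) (splitAt⁻¹-↑ˡ eq))))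
           (splitAt-↑ʳ n (inner G) j)))
    λ ()

-- Liftings of relations between labels

-- Two instances matter: with membership as relation, a related hypergraph is a choice of one
-- element per set label; with the graph of a function it is a relabelling, and naturality follows.
data ERel {A B : Ranked} (R : ∀ {a} → A a → B a → Set) {V : ℕ} : Edge A V → Edge B V → Set where
  rel : ∀ {a x y v} → R x y → ERel R (edge a x v) (edge a y v)

data HRel {A B : Ranked} (R : ∀ {a} → A a → B a → Set) {n : ℕ} : Hyp A n → Hyp B n → Set where
  hrel : ∀ {k es es'} → Pointwise (ERel {A} {B} R) es es' → HRel R (hyp k es) (hyp k es')

pointwise-++⁻ : ∀ {A B : Set} {_∼_ : A → B → Set} xs {ys zs} → Pointwise _∼_ (xs ++ ys) zs →
  Σ[ zs₁ ∈ List _ ] Σ[ zs₂ ∈ List _ ] Pointwise _∼_ xs zs₁ × Pointwise _∼_ ys zs₂ × zs₁ ++ zs₂ ≡ zs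
pointwise-++⁻ []       ps = _ , _ , [] , ps , refl
pointwise-++⁻ (x ∷ xs) (p ∷ ps) with pointwise-++⁻ xs ps
... | _ , _ , qs , rs , refl = _ , _ , p ∷ qs , rs , refl

pointwise-↭ : ∀ {A B : Set} {_∼_ : A → B → Set} {xs ys zs} → xs ↭ ys → Pointwise _∼_ xs zs →
  Σ[ ws ∈ List _ ] zs ↭ ws × Pointwise _∼_ ys ws
pointwise-↭ Perm.refl ps = _ , ↭-refl , ps
pointwise-↭ (Perm.prep x p) (q ∷ qs) with pointwise-↭ p qs
... | _ , p' , qs' = _ , Perm.prep _ p' , q ∷ qs'
pointwise-↭ (Perm.swap x y p) (q ∷ r ∷ qs) with pointwise-↭ p qs
... | _ , p' , qs' = _ , Perm.swap _ _ p' , r ∷ q ∷ qs'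
pointwise-↭ (Perm.trans p₁ p₂) qs with pointwise-↭ p₁ qs
... | _ , p₁' , qs₁ with pointwise-↭ p₂ qs₁
... | _ , p₂' , qs₂ = _ , ↭-trans p₁' p₂' , qs₂

-- Flattening of related hypergraphs

glue : ∀ {a k V} → (Fin a → Fin V) → (Fin k → Fin V) → Fin (a + k) → Fin V
glue {a} o i x = [ o , i ] (splitAt a x)

glue-↑ˡ : ∀ {a k V} (o : Fin a → Fin V) (i : Fin k → Fin V) j → glue o i (j ↑ˡ k) ≡ o j
glue-↑ˡ {a} {k} o i j = cong [ o , i ] (splitAt-↑ˡ a j k)

glue-↑ʳ : ∀ {a k V} (o : Fin a → Fin V) (i : Fin k → Fin V) j → glue o i (a ↑ʳ j) ≡ i j
glue-↑ʳ {a} {k} o i j = cong [ o , i ] (splitAt-↑ʳ a k j)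

glue-cong : ∀ {a k V} (o : Fin a → Fin V) {i i' : Fin k → Fin V} → i ≗ i' → glue o i ≗ glue o i'
glue-cong {a} o i≗i' x with splitAt a x
... | inj₁ _ = refl
... | inj₂ j = i≗i' j

-- The index types of two embeddings that are to be compared are only propositionally equal.
Agree : ∀ {S T V} → (Fin S → Fin V) → (Fin T → Fin V) → Set
Agree f g = ∀ i j → toℕ i ≡ toℕ j → f i ≡ g j

Agree-↑ˡ : ∀ {k S T V} {f : Fin (k + S) → Fin V} {g : Fin (k + T) → Fin V} → Agree f g →
  ∀ j → f (j ↑ˡ S) ≡ g (j ↑ˡ T)
Agree-↑ˡ {S = S} {T} ag j = ag _ _ (trans (toℕ-↑ˡ j S) (sym (toℕ-↑ˡ j T)))

Agree-↑ʳ : ∀ k {S T V} {f : Fin (k + S) → Fin V} {g : Fin (k + T) → Fin V} → Agree f g →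
  Agree (f ∘ (k ↑ʳ_)) (g ∘ (k ↑ʳ_))
Agree-↑ʳ k ag i j eq = ag _ _ (trans (toℕ-↑ʳ k i) (trans (cong (k +_) eq) (sym (toℕ-↑ʳ k j))))

-- `outer` and `nested` name the two embeddings that `flatten` hands to `flattenEdges`, just as
-- `glue` names its local map `ρ`.
outer : ∀ n k T → Fin (n + k) → Fin (n + (k + T))
outer n k T x = cast (+-assoc n k T) (x ↑ˡ T)

nested : ∀ n k T → Fin T → Fin (n + (k + T))
nested n k T j = cast (+-assoc n k T) ((n + k) ↑ʳ j)

-- Relabelling preserves `innerSum` only up to propositional equality. With the number of nested
-- vertices a variable `T`, two flattenings can be given the same vertex type.
flattenAt : ∀ {R : Ranked} {n} k (es : List (Edge (Hyp R) (n + k))) T → innerSum es ≡ T → Hyp R n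
flattenAt {n = n} k es T p = hyp (k + T) (flattenEdges es (outer n k T) (nested n k T ∘ subst Fin p))

flattenAt-≡ : ∀ {R : Ranked} {n} k (es : List (Edge (Hyp R) (n + k))) T p →
  flatten (hyp k es) ≡ flattenAt k es T p
flattenAt-≡ k es _ refl = refl

Agree-subst : ∀ {S T V} (p : S ≡ T) (f : Fin T → Fin V) → Agree (f ∘ subst Fin p) f
Agree-subst refl f i j eq = cong f (toℕ-injective eq)

Agree-sym : ∀ {S T V} {f : Fin S → Fin V} {g : Fin T → Fin V} → Agree f g → Agree g f
Agree-sym ag i j eq = sym (ag j i (sym eq))

module _ {A B : Ranked} {R : ∀ {a} → A a → B a → Set} where

  renE-rel : ∀ {V W} {f g : Fin V → Fin W} → f ≗ g → ∀ {es es'} → Pointwise (ERel {A} {B} R) es es' →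
    Pointwise (ERel R) (List.map (renE f) es) (List.map (renE g) es')
  renE-rel f≗g [] = []
  renE-rel f≗g (rel {v = v} r ∷ rs) rewrite VecP.map-cong f≗g v = rel r ∷ renE-rel f≗g rs

  renE-lift : ∀ {V W} {f : Fin V → Fin W} es {xs} → Pointwise (ERel {A} {B} R) (List.map (renE f) es) xs →
    ∃ λ es' → Pointwise (ERel R) es es' × List.map (renE f) es' ≡ xs
  renE-lift [] [] = [] , [] , refl
  renE-lift (edge a l v ∷ es) (rel r ∷ rs) with renE-lift es rs
  ... | _ , rs' , refl = _ , rel r ∷ rs' , refl

  innerSum-rel : ∀ {V} {es : List (Edge (Hyp A) V)} {es' : List (Edge (Hyp B) V)} →
    Pointwise (ERel (HRel R)) es es' → innerSum es ≡ innerSum es'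
  innerSum-rel [] = refl
  innerSum-rel (rel (hrel {k} _) ∷ rs) = cong (k +_) (innerSum-rel rs)

  flattenEdges-rel : ∀ {W V} {es es'} → Pointwise (ERel {Hyp A} {Hyp B} (HRel R)) es es' →
    (out : Fin W → Fin V) → ∀ {emb emb'} → Agree emb emb' →
    Pointwise (ERel R) (flattenEdges es out emb) (flattenEdges es' out emb')
  flattenEdges-rel [] out ag = []
  flattenEdges-rel (rel {a} {v = v} (hrel {k} rs) ∷ rss) out ag =
    Pointwise.++⁺ (renE-rel (glue-cong {a} {k} (out ∘ Vec.lookup v) (Agree-↑ˡ {k} ag)) rs)
                 (flattenEdges-rel rss out (Agree-↑ʳ k ag))

  -- A list related to a concatenation splits into one part per nested hypergraph, and each part
  -- pulls back along the renaming, which leaves labels alone. The quantification over `emb'` is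
  -- there because the new list has its own `innerSum` as index bound.
  flattenEdges-lift : ∀ {W V} (es : List (Edge (Hyp A) W)) (out : Fin W → Fin V) emb {xs} →
    Pointwise (ERel {A} {B} R) (flattenEdges es out emb) xs →
    ∃ λ es' → Pointwise (ERel (HRel R)) es es' × (∀ emb' → Agree emb emb' → flattenEdges es' out emb' ≡ xs)
  flattenEdges-lift [] out emb [] = [] , [] , λ _ _ → refl
  flattenEdges-lift (edge a (hyp k hs) v ∷ es) out emb rs
    with pointwise-++⁻ (List.map (renE _) hs) rs
  ... | _ , _ , rs₁ , rs₂ , refl
    with renE-lift hs rs₁ | flattenEdges-lift es out (emb ∘ (k ↑ʳ_)) rs₂
  ... | hs' , qs₁ , refl | es' , qs₂ , eq =
    edge a (hyp k hs') v ∷ es' , rel (hrel qs₁) ∷ qs₂ , λ emb' ag →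
      cong₂ _++_ (ListP.map-cong (renE-cong (glue-cong {a} {k} (out ∘ Vec.lookup v) (sym ∘ Agree-↑ˡ {k} ag))) hs')
                 (eq _ (Agree-↑ʳ k ag))

  flatten-rel : ∀ {n} {G : Hyp (Hyp A) n} {G'} → HRel (HRel R) G G' → HRel R (flatten G) (flatten G')
  flatten-rel {n} {hyp k es} {hyp k es'} (hrel rs)
    rewrite flattenAt-≡ k es _ (innerSum-rel rs) =
    hrel (flattenEdges-rel rs (outer n k _) (Agree-subst (innerSum-rel rs) _))

  flatten-lift : ∀ {n} (G : Hyp (Hyp A) n) {X} → HRel R (flatten G) X →
    ∃ λ G' → HRel (HRel R) G G' × flatten G' ≡ X
  flatten-lift {n} (hyp k es) (hrel rs) with flattenEdges-lift es _ _ rs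
  ... | es' , qs , eq = hyp k es' , hrel qs ,
    trans (flattenAt-≡ k es' (innerSum es) p) (cong (hyp _) (eq _ (Agree-sym (Agree-subst p _))))
    where p = sym (innerSum-rel qs)

  HRel-Iso : ∀ {n} {G G' : Hyp A n} {X} → Iso G G' → HRel {A} {B} R G X → ∃ λ X' → Iso X X' × HRel R G' X'
  HRel-Iso {G' = hyp k' es'} i (hrel rs)
    with pointwise-↭ (Iso.edg i) (renE-rel {f = Inverse.to (Iso.bij i)} (λ _ → refl) rs)
  ... | ws , p , rs' = hyp k' ws , record { bij = bij ; src = src ; edg = p } , hrel rs'
    where open Iso i

module _ {A B : Ranked} (f : ∀ {a} → A a → B a) where

  mapH-rel : {R : ∀ {a} → A a → B a → Set} → (∀ {a} (x : A a) → R x (f x)) →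
    ∀ {n} (G : Hyp A n) → HRel R G (mapH f G)
  mapH-rel {R} r (hyp k es) = hrel (go es)
    where
    go : ∀ {V} (es : List (Edge A V)) → Pointwise (ERel R) es (List.map (mapE f) es)
    go []       = []
    go (e ∷ es) = rel (r (lab e)) ∷ go es

  rel-mapH : ∀ {n} {G : Hyp A n} {G'} → HRel (λ x y → f x ≡ y) G G' → mapH f G ≡ G'
  rel-mapH (hrel {k} rs) = cong (hyp k) (go rs)
    where
    go : ∀ {V} {es : List (Edge A V)} {es'} → Pointwise (ERel (λ x y → f x ≡ y)) es es' →
      List.map (mapE f) es ≡ es'
    go [] = refl
    go (rel refl ∷ rs) = cong (_ ∷_) (go rs)

-- Parametricity at the graph of `f`: relabelling inside the labels relates `G` to its image, and
-- `flatten` preserves related pairs.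
flatten-natural : ∀ {A B : Ranked} (f : ∀ {a} → A a → B a) {n} (G : Hyp (Hyp A) n) →
  mapH f (flatten G) ≡ flatten (mapH (mapH f) G)
flatten-natural {A} {B} f G =
  rel-mapH f (flatten-rel (mapH-rel (mapH f) (mapH-rel f {λ x y → f x ≡ y} λ _ → refl) G))

-- Finite types, algebras and their products

does-true : ∀ {P : Set} (P? : Dec P) → does P? ≡ true → P
does-true (yes p) _ = p

Finite : Set → Set
Finite A = Σ[ k ∈ ℕ ] (A ↔ Fin k)

finite-Bool : Finite Bool
finite-Bool = 2 , ↔-sym 2↔Bool

finite-× : ∀ {A B} → Finite A → Finite B → Finite (A × B)
finite-× (j , f) (k , g) = j * k , ↔-trans (f ×-↔ g) (↔-sym *↔×)

finite-Vec : ∀ {A} → Finite A → ∀ n → Finite (Vec A n)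
finite-Vec fin zero    = 1 , mk↔ₛ′ (λ _ → zero) (λ _ → []) (λ { zero → refl }) λ { [] → refl }
finite-Vec fin (suc n) with finite-× fin (finite-Vec fin n)
... | k , f = k , ↔-trans
  (mk↔ₛ′ Vec.uncons (λ (x , xs) → x ∷ xs) (λ _ → refl) λ { (x ∷ xs) → refl }) f

-- The carriers are arbitrary finite types, so that pairs, subsets and vectors serve directly;
-- `Transport` replaces them by `Fin` at the end.
record Alg : Set₁ where
  field
    C       : Ranked
    finite  : ∀ n → Finite (C n)
    π       : ∀ {n} → Hyp C n → C n
    π-iso   : ∀ {n} {G G' : Hyp C n} → Iso G G' → π G ≡ π G'
    π-unit  : ∀ {n} (a : C n) → π (unit a) ≡ a
    π-assoc : ∀ {n} (G : Hyp (Hyp C) n) → π (flatten G) ≡ π (mapH π G)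

module Product (A B : Alg) where
  module A = Alg A
  module B = Alg B

  algebra : Alg
  algebra = record
    { C       = λ n → A.C n × B.C n
    ; finite  = λ n → finite-× (A.finite n) (B.finite n)
    ; π       = λ G → A.π (mapH proj₁ G) , B.π (mapH proj₂ G)
    ; π-iso   = λ i → cong₂ _,_ (A.π-iso (mapH-Iso proj₁ i)) (B.π-iso (mapH-Iso proj₂ i))
    ; π-unit  = λ a → cong₂ _,_ (A.π-unit _) (B.π-unit _)
    ; π-assoc = λ G → cong₂ _,_
        (begin
          A.π (mapH proj₁ (flatten G))                  ≡⟨ cong A.π (flatten-natural proj₁ G) ⟩
          A.π (flatten (mapH (mapH proj₁) G))           ≡⟨ A.π-assoc _ ⟩
          A.π (mapH A.π (mapH (mapH proj₁) G))          ≡⟨ cong A.π (sym (mapH-∘ A.π (mapH proj₁) G)) ⟩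
          A.π (mapH (λ H → A.π (mapH proj₁ H)) G)       ≡⟨ cong A.π (mapH-∘ proj₁ _ G) ⟩
          A.π (mapH proj₁ (mapH _ G))                   ∎)
        (begin
          B.π (mapH proj₂ (flatten G))                  ≡⟨ cong B.π (flatten-natural proj₂ G) ⟩
          B.π (flatten (mapH (mapH proj₂) G))           ≡⟨ B.π-assoc _ ⟩
          B.π (mapH B.π (mapH (mapH proj₂) G))          ≡⟨ cong B.π (sym (mapH-∘ B.π (mapH proj₂) G)) ⟩
          B.π (mapH (λ H → B.π (mapH proj₂ H)) G)       ≡⟨ cong B.π (mapH-∘ proj₂ _ G) ⟩
          B.π (mapH proj₂ (mapH _ G))                   ∎)
    }

-- Counting

-- A finite quotient of (ℕ, +) in which n ≡ k (mod m) can be read off; for m = 0 this is the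
-- quotient identifying all numbers above k.
record Residues (m k : ℕ) : Set where
  field
    bound    : ℕ
    nf       : ℕ → Fin bound
    nf-toℕ   : ∀ a → nf (toℕ a) ≡ a
    nf-+     : ∀ x y → nf (toℕ (nf x) + y) ≡ nf (x + y)
    nf-modEq : ∀ x → modEq m (toℕ (nf x)) k ≡ modEq m x k

-- Once a summand reaches `c`, so does every sum containing it, and truncating early loses nothing.
⊓-absorb-+ : ∀ x y c → (x ⊓ c + y) ⊓ c ≡ (x + y) ⊓ c
⊓-absorb-+ x y c with ≤-total x c
... | inj₁ x≤c = cong (λ z → (z + y) ⊓ c) (m≤n⇒m⊓n≡m x≤c)
... | inj₂ c≤x = begin
  (x ⊓ c + y) ⊓ c  ≡⟨ cong (λ z → (z + y) ⊓ c) (m≥n⇒m⊓n≡n c≤x) ⟩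
  (c + y) ⊓ c      ≡⟨ m≥n⇒m⊓n≡n (m≤m+n c y) ⟩
  c                ≡⟨ m≥n⇒m⊓n≡n (≤-trans c≤x (m≤m+n x y)) ⟨
  (x + y) ⊓ c      ∎

-- The cap lies one above `k`, so truncation never collapses a larger number onto `k`.
⊓-suc-≡ᵇ : ∀ x k → (x ⊓ suc k ≡ᵇ k) ≡ (x ≡ᵇ k)
⊓-suc-≡ᵇ zero    k       = refl
⊓-suc-≡ᵇ (suc x) (suc k) = ⊓-suc-≡ᵇ x k
⊓-suc-≡ᵇ (suc zero)    zero = refl
⊓-suc-≡ᵇ (suc (suc x)) zero = refl

residues : ∀ m k → Residues m k
residues zero k = record
  -- The values 0 to `k` are exact, and `suc k` stands for everything larger.
  { bound    = suc (suc k)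
  ; nf       = nf
  ; nf-toℕ   = λ a → toℕ-injective (trans (toℕ-nf _) (m≤n⇒m⊓n≡m (s≤s⁻¹ (toℕ<n a))))
  ; nf-+     = λ x y → toℕ-injective (begin
      toℕ (nf (toℕ (nf x) + y))          ≡⟨ toℕ-nf _ ⟩
      (toℕ (nf x) + y) ⊓ suc k           ≡⟨ cong (λ z → (z + y) ⊓ suc k) (toℕ-nf x) ⟩
      (x ⊓ suc k + y) ⊓ suc k            ≡⟨ ⊓-absorb-+ x y (suc k) ⟩
      (x + y) ⊓ suc k                    ≡⟨ toℕ-nf _ ⟨
      toℕ (nf (x + y))                   ∎)
  ; nf-modEq = λ x → trans (cong (_≡ᵇ k) (toℕ-nf x)) (⊓-suc-≡ᵇ x k)
  }
  where
  nf : ℕ → Fin (suc (suc k))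
  nf x = fromℕ< (s≤s (m⊓n≤n x (suc k)))

  toℕ-nf : ∀ x → toℕ (nf x) ≡ x ⊓ suc k
  toℕ-nf x = toℕ-fromℕ< _
residues m@(suc _) k = record
  { bound    = m
  ; nf       = _mod m
  ; nf-toℕ   = λ a → toℕ-injective (trans (toℕ-mod (toℕ a)) (m<n⇒m%n≡m (toℕ<n a)))
  ; nf-+     = λ x y → toℕ-injective (begin
      toℕ ((toℕ (x mod m) + y) mod m)    ≡⟨ toℕ-mod (toℕ (x mod m) + y) ⟩
      (toℕ (x mod m) + y) % m            ≡⟨ cong (λ z → (z + y) % m) (toℕ-mod x) ⟩
      (x % m + y) % m                    ≡⟨ %-distribˡ-+ (x % m) y m ⟩
      (x % m % m + y % m) % m            ≡⟨ cong (λ z → (z + y % m) % m) (m%n%n≡m%n x m) ⟩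
      (x % m + y % m) % m                ≡⟨ %-distribˡ-+ x y m ⟨
      (x + y) % m                        ≡⟨ toℕ-mod (x + y) ⟨
      toℕ ((x + y) mod m)                ∎)
  ; nf-modEq = λ x → cong (_≡ᵇ k % m) (trans (cong (_% m) (toℕ-mod x)) (m%n%n≡m%n x m))
  }
  where
  toℕ-mod : ∀ x → toℕ (x mod m) ≡ x % m
  toℕ-mod x = toℕ-fromℕ< _

module Counting {m k : ℕ} (res : Residues m k) where
  open Residues res

  C : Ranked
  C _ = Fin bound

  total : ∀ {V} → List (Edge C V) → ℕ
  total es = sum (List.map (λ e → toℕ (lab e)) es)

  total-++ : ∀ {V} (es es' : List (Edge C V)) → total (es ++ es') ≡ total es + total es'
  total-++ es es' = trans (cong sum (ListP.map-++ _ es es')) (sum-++ (List.map _ es) _)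

  total-ren : ∀ {V W} (f : Fin V → Fin W) (es : List (Edge C V)) → total (List.map (renE f) es) ≡ total es
  total-ren f es = cong sum (sym (ListP.map-∘ es))

  π : ∀ {n} → Hyp C n → C n
  π G = nf (total (edges G))

  nf-+ʳ : ∀ x {y z} → nf y ≡ nf z → nf (x + y) ≡ nf (x + z)
  nf-+ʳ x {y} {z} eq = begin
    nf (x + y)           ≡⟨ cong nf (+-comm x y) ⟩
    nf (y + x)           ≡⟨ nf-+ y x ⟨
    nf (toℕ (nf y) + x)  ≡⟨ cong (λ a → nf (toℕ a + x)) eq ⟩
    nf (toℕ (nf z) + x)  ≡⟨ nf-+ z x ⟩
    nf (z + x)           ≡⟨ cong nf (+-comm z x) ⟩
    nf (x + z)           ∎

  -- Renaming leaves labels alone, so the total of a flattening is the sum of the nested totals, and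
  -- each of these may be reduced by `nf` before adding.
  total-flatten : ∀ {W V} (es : List (Edge (Hyp C) W)) (out : Fin W → Fin V) emb →
    nf (total (flattenEdges es out emb)) ≡ nf (total (List.map (mapE π) es))
  total-flatten [] out emb = refl
  total-flatten (edge a H v ∷ es) out emb = begin
    nf (total (List.map (renE _) (edges H) ++ FE))   ≡⟨ cong nf (total-++ (List.map (renE _) (edges H)) FE) ⟩
    nf (total (List.map (renE _) (edges H)) + total FE)
                                      ≡⟨ cong (λ z → nf (z + total FE)) (total-ren _ (edges H)) ⟩
    nf (total (edges H) + total FE)   ≡⟨ nf-+ʳ (total (edges H)) (total-flatten es out _) ⟩
    nf (total (edges H) + total es')  ≡⟨ nf-+ _ _ ⟨
    nf (toℕ (π H) + total es')        ∎
    where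
    FE  = flattenEdges es out (emb ∘ (inner H ↑ʳ_))
    es' = List.map (mapE π) es

  algebra : Alg
  algebra = record
    { C       = C
    ; finite  = λ _ → bound , ↔-refl
    ; π       = π
    ; π-iso   = λ {n} {G} i → cong nf (trans (sym (total-ren _ (edges G))) (sum-↭ (PermP.map⁺ _ (Iso.edg i))))
    ; π-unit  = λ a → trans (cong nf (+-comm _ 0)) (nf-toℕ a)
    ; π-assoc = λ G → total-flatten (edges G) _ _
    }

-- Powersets

module Power (A : Alg) where
  open Alg A

  size : ℕ → ℕ
  size n = proj₁ (finite n)

  index : ∀ {n} → C n → Fin (size n)
  index {n} = Inverse.to (proj₂ (finite n))

  at : ∀ {n} → Fin (size n) → C n
  at {n} = Inverse.from (proj₂ (finite n))

  at-index : ∀ {n} (t : C n) → at (index t) ≡ t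
  at-index {n} = Inverse.strictlyInverseʳ (proj₂ (finite n))

  index-at : ∀ {n} (i : Fin (size n)) → index {n} (at i) ≡ i
  index-at {n} = Inverse.strictlyInverseˡ (proj₂ (finite n))

  P : Ranked
  P n = Subset (size n)

  _∋_ : ∀ {n} → P n → C n → Set
  S ∋ t = index t ∈ₛ S

  ∋-ext : ∀ {n} {S S' : P n} → (∀ t → S ∋ t → S' ∋ t) → (∀ t → S' ∋ t → S ∋ t) → S ≡ S'
  ∋-ext {S = S} {S'} f g = ⊆-antisym
    (λ {i} i∈S  → subst (_∈ₛ S') (index-at i) (f (at i) (subst (_∈ₛ S)  (sym (index-at i)) i∈S)))
    (λ {i} i∈S' → subst (_∈ₛ S)  (index-at i) (g (at i) (subst (_∈ₛ S') (sym (index-at i)) i∈S')))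

  comprehension : ∀ {n} {Q : C n → Set} → (∀ t → Dec (Q t)) → P n
  comprehension Q? = Vec.tabulate (λ i → does (Q? (at i)))

  ∋-comprehension : ∀ {n} {Q : C n → Set} (Q? : ∀ t → Dec (Q t)) t → comprehension Q? ∋ t ⇔ Q t
  ∋-comprehension {Q = Q} Q? t = mk⇔
    (λ t∈ → subst Q (at-index t) (does-true (Q? _)
              (trans (sym (VecP.lookup∘tabulate _ (index t))) (VecP.[]=⇒lookup t∈))))
    (λ q → VecP.lookup⇒[]= _ _ (trans (VecP.lookup∘tabulate _ (index t))
              (dec-true (Q? _) (subst Q (sym (at-index t)) q))))

  members : ∀ {n} → P n → List (C n)
  members S = List.filter (λ t → index t ∈? S) (List.map at (List.allFin _))

  -- Hyperedges choose independently, so two with the same label may receive different elements.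
  -- Listing all choices makes membership in the product decidable.
  choices : ∀ {V} → List (Edge P V) → List (List (Edge C V))
  choices []                = [] ∷ []
  choices (edge a S v ∷ es) =
    cartesianProductWith _∷_ (List.map (λ t → edge a t v) (members S)) (choices es)

  ∈-choices⁺ : ∀ {V} {es : List (Edge P V)} {xs} → Pointwise (ERel _∋_) es xs → xs ∈ choices es
  ∈-choices⁺ [] = here refl
  ∈-choices⁺ (rel {a} {S} {t} {v} t∈S ∷ ps) = ∈-cartesianProductWith⁺ _∷_
    (∈-map⁺ (λ t → edge a t v) (∈-filter⁺ (λ t → index t ∈? S) t∈at t∈S))
    (∈-choices⁺ ps)
    where
    t∈at : t ∈ List.map at (List.allFin (size a))
    t∈at = subst (_∈ List.map at (List.allFin (size a))) (at-index t) (∈-map⁺ at (∈-allFin (index t)))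

  ∈-choices⁻ : ∀ {V} (es : List (Edge P V)) {xs} → xs ∈ choices es → Pointwise (ERel _∋_) es xs
  ∈-choices⁻ [] (here refl) = []
  ∈-choices⁻ (edge a S v ∷ es) xs∈
    with ∈-cartesianProductWith⁻ _∷_ (List.map (λ t → edge a t v) (members S)) (choices es) xs∈
  ... | _ , _ , x∈ , ys∈ , refl with ∈-map⁻ (λ t → edge a t v) x∈
  ... | t , t∈ , refl =
    rel (proj₂ (∈-filter⁻ (λ t → index t ∈? S) {xs = List.map at (List.allFin _)} t∈)) ∷ ∈-choices⁻ es ys∈

  chosen? : ∀ {n} (G : Hyp P n) t → Dec (Any (λ xs → index (π (hyp (inner G) xs)) ≡ index t) (choices (edges G)))
  chosen? G t = Any.any? (λ xs → index (π (hyp (inner G) xs)) Fin.≟ index t) (choices (edges G))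

  π' : ∀ {n} → Hyp P n → P n
  π' G = comprehension (chosen? G)

  ∋-π'⁺ : ∀ {n} {G : Hyp P n} {X} → HRel _∋_ G X → π' G ∋ π X
  ∋-π'⁺ {G = G} (hrel ps) = Equivalence.from (∋-comprehension (chosen? G) _) (lose (∈-choices⁺ ps) refl)

  ∋-π'⁻ : ∀ {n} (G : Hyp P n) {t} → π' G ∋ t → ∃ λ X → HRel _∋_ G X × π X ≡ t
  ∋-π'⁻ G@(hyp k es) {t} t∈ with find (Equivalence.to (∋-comprehension (chosen? G) t) t∈)
  ... | xs , xs∈ , eq = hyp k xs , hrel (∈-choices⁻ es xs∈) ,
    trans (sym (at-index _)) (trans (cong at eq) (at-index t))

  π'-iso : ∀ {n} {G G' : Hyp P n} → Iso G G' → ∀ t → π' G ∋ t → π' G' ∋ t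
  π'-iso {G = G} {G'} i t t∈ with ∋-π'⁻ G t∈
  ... | X , r , refl with HRel-Iso i r
  ... | X' , j , r' = subst (π' G' ∋_) (sym (π-iso j)) (∋-π'⁺ r')

  -- Choosing an element of each product set amounts to choosing inside each nested hypergraph and
  -- multiplying; `fold` is the converse.
  unfold : ∀ {V} (es : List (Edge (Hyp P) V)) {ys} → Pointwise (ERel _∋_) (List.map (mapE π') es) ys →
    ∃ λ xs → Pointwise (ERel (HRel _∋_)) es xs × List.map (mapE π) xs ≡ ys
  unfold [] [] = [] , [] , refl
  unfold (edge a H v ∷ es) (rel y∈ ∷ ps) with ∋-π'⁻ H y∈ | unfold es ps
  ... | X , r , refl | xs , rs , refl = edge a X v ∷ xs , rel r ∷ rs , refl

  fold : ∀ {V} {es : List (Edge (Hyp P) V)} {xs} → Pointwise (ERel (HRel _∋_)) es xs →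
    Pointwise (ERel _∋_) (List.map (mapE π') es) (List.map (mapE π) xs)
  fold []           = []
  fold (rel r ∷ rs) = rel (∋-π'⁺ r) ∷ fold rs

  algebra : Alg
  algebra = record
    { C       = P
    ; finite  = λ n → finite-Vec finite-Bool (size n)
    ; π       = π'
    ; π-iso   = λ i → ∋-ext (π'-iso i) (π'-iso (Iso-sym i))
    ; π-unit  = λ S → ∋-ext (unit⁻ S) λ t t∈ → subst (π' (unit S) ∋_) (π-unit t) (∋-π'⁺ (hrel (rel t∈ ∷ [])))
    ; π-assoc = λ G → ∋-ext (assoc⁺ G) (assoc⁻ G)
    }
    where
    unit⁻ : ∀ {n} (S : P n) t → π' (unit S) ∋ t → S ∋ t
    unit⁻ S t t∈ with ∋-π'⁻ (unit S) t∈
    ... | _ , hrel (rel u∈ ∷ []) , refl = subst (S ∋_) (sym (π-unit _)) u∈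

    -- A choice on the flattening lifts to one on the nested hypergraph, where associativity in `A`
    -- applies.
    assoc⁺ : ∀ {n} (G : Hyp (Hyp P) n) t → π' (flatten G) ∋ t → π' (mapH π' G) ∋ t
    assoc⁺ G t t∈ with ∋-π'⁻ (flatten G) t∈
    ... | _ , r , refl with flatten-lift G r
    ... | X , hrel rs , refl = subst (π' (mapH π' G) ∋_) (sym (π-assoc X)) (∋-π'⁺ (hrel (fold rs)))

    assoc⁻ : ∀ {n} (G : Hyp (Hyp P) n) t → π' (mapH π' G) ∋ t → π' (flatten G) ∋ t
    assoc⁻ G@(hyp k es) t t∈ with ∋-π'⁻ (mapH π' G) t∈
    ... | _ , hrel rs , refl with unfold es rs
    ... | xs , qs , refl = subst (π' (flatten G) ∋_) (π-assoc (hyp k xs)) (∋-π'⁺ (flatten-rel (hrel {es = es} qs)))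

-- Vertices of a flattened hypergraph

data Split {a k} : Fin (a + k) → Set where
  left  : ∀ i → Split (i ↑ˡ k)
  right : ∀ j → Split (a ↑ʳ j)

split : ∀ a {k} (x : Fin (a + k)) → Split {a} {k} x
split a x with splitAt a x in eq
... | inj₁ i = subst Split (splitAt⁻¹-↑ˡ eq) (left i)
... | inj₂ j = subst Split (splitAt⁻¹-↑ʳ eq) (right j)

↑ˡ≢↑ʳ : ∀ {a k} (i : Fin a) (j : Fin k) → i ↑ˡ k ≢ a ↑ʳ j
↑ˡ≢↑ʳ {a} {k} i j eq = contradiction
  (trans (sym (splitAt-↑ˡ a i k)) (trans (cong (splitAt a) eq) (splitAt-↑ʳ a k j))) λ ()

cast-injective : ∀ {m n} (eq : m ≡ n) {i j : Fin m} → cast eq i ≡ cast eq j → i ≡ j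
cast-injective eq {i} {j} p =
  toℕ-injective (trans (sym (toℕ-cast eq i)) (trans (cong toℕ p) (toℕ-cast eq j)))

module _ (n k T : ℕ) where

  outer-injective : ∀ {x y} → outer n k T x ≡ outer n k T y → x ≡ y
  outer-injective = ↑ˡ-injective T _ _ ∘ cast-injective (+-assoc n k T)

  nested-injective : ∀ {i j} → nested n k T i ≡ nested n k T j → i ≡ j
  nested-injective = ↑ʳ-injective (n + k) _ _ ∘ cast-injective (+-assoc n k T)

  outer≢nested : ∀ x j → outer n k T x ≢ nested n k T j
  outer≢nested x j = ↑ˡ≢↑ʳ x j ∘ cast-injective (+-assoc n k T)

  outer-source : ∀ i → outer n k T (i ↑ˡ k) ≡ i ↑ˡ (k + T)
  outer-source i = toℕ-injective (begin
    toℕ (outer n k T (i ↑ˡ k))  ≡⟨ toℕ-cast (+-assoc n k T) _ ⟩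
    toℕ ((i ↑ˡ k) ↑ˡ T)         ≡⟨ toℕ-↑ˡ (i ↑ˡ k) T ⟩
    toℕ (i ↑ˡ k)                ≡⟨ toℕ-↑ˡ i k ⟩
    toℕ i                       ≡⟨ toℕ-↑ˡ i (k + T) ⟨
    toℕ (i ↑ˡ (k + T))          ∎)

  -- With `nested-inner` this says that the internal vertices of a flattening are those of the outer
  -- hypergraph followed by the nested ones.
  outer-inner : ∀ j → outer n k T (n ↑ʳ j) ≡ n ↑ʳ (j ↑ˡ T)
  outer-inner j = toℕ-injective (begin
    toℕ (outer n k T (n ↑ʳ j))  ≡⟨ toℕ-cast (+-assoc n k T) _ ⟩
    toℕ ((n ↑ʳ j) ↑ˡ T)         ≡⟨ toℕ-↑ˡ (n ↑ʳ j) T ⟩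
    toℕ (n ↑ʳ j)                ≡⟨ toℕ-↑ʳ n j ⟩
    n + toℕ j                   ≡⟨ cong (n +_) (toℕ-↑ˡ j T) ⟨
    n + toℕ (j ↑ˡ T)            ≡⟨ toℕ-↑ʳ n (j ↑ˡ T) ⟨
    toℕ (n ↑ʳ (j ↑ˡ T))         ∎)

  nested-inner : ∀ j → nested n k T j ≡ n ↑ʳ (k ↑ʳ j)
  nested-inner j = toℕ-injective (begin
    toℕ (nested n k T j)        ≡⟨ toℕ-cast (+-assoc n k T) _ ⟩
    toℕ ((n + k) ↑ʳ j)          ≡⟨ toℕ-↑ʳ (n + k) j ⟩
    n + k + toℕ j               ≡⟨ +-assoc n k _ ⟩
    n + (k + toℕ j)             ≡⟨ cong (n +_) (toℕ-↑ʳ k j) ⟨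
    n + toℕ (k ↑ʳ j)            ≡⟨ toℕ-↑ʳ n (k ↑ʳ j) ⟨
    toℕ (n ↑ʳ (k ↑ʳ j))         ∎)

tabulate-+ : ∀ {A : Set} m {n} (f : Fin (m + n) → A) →
  tabulate f ≡ tabulate (f ∘ (_↑ˡ n)) ++ tabulate (f ∘ (m ↑ʳ_))
tabulate-+ zero    f = refl
tabulate-+ (suc m) f = cong (f zero ∷_) (tabulate-+ m (f ∘ suc))

++-interchange : ∀ {A : Set} (xs ys zs ws : List A) → (xs ++ ys) ++ (zs ++ ws) ↭ (xs ++ zs) ++ (ys ++ ws)
++-interchange = interchange (CommutativeMonoid.commutativeSemigroup PermP.++-commutativeMonoid)

-- Marking the internal vertices

module Marking (A : Alg) (μ : Alg.C A 1) where
  open Alg A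

  markEdge : ∀ {V} → Fin V → Edge C V
  markEdge x = edge 1 μ (x ∷ [])

  markEdge-injective : ∀ {V} {x y : Fin V} → markEdge x ≡ markEdge y → x ≡ y
  markEdge-injective refl = refl

  marks : ∀ {k V} → (Fin k → Fin V) → List (Edge C V)
  marks f = tabulate (markEdge ∘ f)

  marks-⊆ : ∀ {k k' V} (f : Fin k → Fin V) (g : Fin k' → Fin V) → (∀ i → ∃ λ j → f i ≡ g j) →
    ∀ {e} → e ∈ marks f → e ∈ marks g
  marks-⊆ f g f⊆g e∈ with ∈-tabulate⁻ e∈
  ... | i , refl with f⊆g i
  ... | j , eq rewrite eq = ∈-tabulate⁺ j

  -- Distinct vertices have distinct marks, and two duplicate-free lists with the same elements are
  -- permutations of each other.
  marks-↭ : ∀ {k k' V} {f : Fin k → Fin V} {g : Fin k' → Fin V} →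
    (∀ {i j} → f i ≡ f j → i ≡ j) → (∀ {i j} → g i ≡ g j → i ≡ j) →
    (∀ i → ∃ λ j → f i ≡ g j) → (∀ j → ∃ λ i → g j ≡ f i) → marks f ↭ marks g
  marks-↭ {f = f} {g} f-inj g-inj f⊆g g⊆f = ∼bag⇒↭ (unique∧set⇒bag
    (Unique.tabulate⁺ (f-inj ∘ markEdge-injective)) (Unique.tabulate⁺ (g-inj ∘ markEdge-injective))
    (mk⇔ (marks-⊆ f g f⊆g) (marks-⊆ g f g⊆f)))

  -- Sources stay unmarked: each is marked by the surrounding hypergraph in which it becomes
  -- internal, so no vertex is marked twice.
  mark : ∀ {n} → Hyp C n → Hyp C n
  mark {n} (hyp k es) = hyp k (marks (n ↑ʳ_) ++ es)

  mark-Iso : ∀ {n} {G G' : Hyp C n} → Iso G G' → Iso (mark G) (mark G')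
  mark-Iso {n} {hyp k es} {hyp k' es'} i = record
    { bij = bij
    ; src = src
    ; edg = ↭-trans (↭-reflexive (ListP.map-++ (renE to) (marks (n ↑ʳ_)) es))
              (PermP.++⁺ (↭-trans (↭-reflexive (ListP.map-tabulate _ (renE to)))
                (marks-↭ (↑ʳ-injective n _ _ ∘ Iso-injective i) (↑ʳ-injective n _ _) (Iso-inner i) onto)) edg)
    }
    where
    open Iso i
    open Inverse bij
    onto : ∀ j → ∃ λ j' → n ↑ʳ j ≡ to (n ↑ʳ j')
    onto j with Iso-inner (Iso-sym i) j
    ... | j' , eq = j' , trans (sym (strictlyInverseˡ _)) (cong to eq)

  -- Each label contributes the marks of its own internal vertices just before its hyperedges;
  -- interchanging blocks collects these marks at the front.
  flattenEdges-mark : ∀ {W V} (es : List (Edge (Hyp C) W)) (out : Fin W → Fin V)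
    (emb : Fin (innerSum es) → Fin V) emb' → Agree emb' emb →
    flattenEdges (List.map (mapE mark) es) out emb' ↭ marks emb ++ flattenEdges es out emb
  flattenEdges-mark [] out emb emb' ag = ↭-refl
  flattenEdges-mark (edge a (hyp k hs) v ∷ es) out emb emb' ag =
    ↭-trans (PermP.++⁺ (↭-reflexive head-≡) (flattenEdges-mark es out (emb ∘ (k ↑ʳ_)) _ (Agree-↑ʳ k ag)))
    (↭-trans (++-interchange ms hs' ms' FE)
             (↭-reflexive (cong (_++ (hs' ++ FE)) (sym (tabulate-+ k (markEdge ∘ emb))))))
    where
    ρ' ρ : Fin (a + k) → Fin _
    ρ' = glue (out ∘ Vec.lookup v) (λ j → emb' (j ↑ˡ innerSum (List.map (mapE mark) es)))
    ρ  = glue (out ∘ Vec.lookup v) (λ j → emb (j ↑ˡ innerSum es))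
    ms  = marks (λ (j : Fin k) → emb (j ↑ˡ innerSum es))
    ms' = marks (emb ∘ (k ↑ʳ_))
    hs' = List.map (renE ρ) hs
    FE  = flattenEdges es out (emb ∘ (k ↑ʳ_))
    head-≡ : List.map (renE ρ') (marks (a ↑ʳ_) ++ hs) ≡ ms ++ hs'
    head-≡ = trans (ListP.map-cong (renE-cong (glue-cong _ (Agree-↑ˡ {k} ag))) (marks (a ↑ʳ_) ++ hs))
      (trans (ListP.map-++ (renE ρ) (marks (a ↑ʳ_)) hs)
      (cong (_++ hs') (trans (ListP.map-tabulate _ (renE ρ))
        (ListP.tabulate-cong (cong markEdge ∘ glue-↑ʳ (out ∘ Vec.lookup v) _)))))

  -- The hyperedges `us` are wrapped as units so that they can sit beside nested hypergraphs;
  -- flattening a unit gives the hyperedge back, renamed by `out`.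
  flattenEdges-units : ∀ {W V} (us : List (Edge C W)) (es : List (Edge (Hyp C) W)) (out : Fin W → Fin V)
    (emb : Fin (innerSum es) → Fin V) emb' → Agree emb' emb →
    flattenEdges (List.map (mapE unit) us ++ List.map (mapE mark) es) out emb' ↭
    List.map (renE out) us ++ (marks emb ++ flattenEdges es out emb)
  flattenEdges-units [] es out emb emb' ag = flattenEdges-mark es out emb emb' ag
  flattenEdges-units (edge a l v ∷ us) es out emb emb' ag =
    ↭-trans (↭-reflexive (cong (λ w → edge a l w ∷ _) (begin
      Vec.map ρ (Vec.tabulate (_↑ˡ 0))   ≡⟨ VecP.tabulate-∘ ρ (_↑ˡ 0) ⟨
      Vec.tabulate (ρ ∘ (_↑ˡ 0))         ≡⟨ VecP.tabulate-cong (glue-↑ˡ (out ∘ Vec.lookup v) (λ j → emb' (j ↑ˡ _))) ⟩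
      Vec.tabulate (out ∘ Vec.lookup v)  ≡⟨ VecP.tabulate-∘ out (Vec.lookup v) ⟩
      Vec.map out (Vec.tabulate (Vec.lookup v)) ≡⟨ cong (Vec.map out) (VecP.tabulate∘lookup v) ⟩
      Vec.map out v                      ∎)))
    (Perm.prep _ (flattenEdges-units us es out emb emb' ag))
    where
    ρ : Fin (a + 0) → Fin _
    ρ = glue (out ∘ Vec.lookup v) (λ j → emb' (j ↑ˡ _))

  innerSum-units : ∀ {W} (us : List (Edge C W)) (es : List (Edge (Hyp C) W)) →
    innerSum (List.map (mapE unit) us ++ List.map (mapE mark) es) ≡ innerSum es
  innerSum-units []       []       = refl
  innerSum-units []       (e ∷ es) = cong (inner (lab e) +_) (innerSum-units [] es)
  innerSum-units (u ∷ us) es       = innerSum-units us es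

  -- Both sides evaluate one nested hypergraph, made of the marked labels and of the outer marks
  -- wrapped as units. Multiplying its labels first gives the right side; flattening it first gives,
  -- up to the order of hyperedges, the marked flattening.
  assoc : ∀ {n} (G : Hyp (Hyp C) n) → π (mark (flatten G)) ≡ π (mark (mapH (λ H → π (mark H)) G))
  assoc {n} (hyp k es) = sym (begin
    π (hyp k (us ++ List.map (mapE (λ H → π (mark H))) es))  ≡⟨ cong (λ xs → π (hyp k xs)) labels-≡ ⟨
    π (mapH π (hyp k es⁺))                                   ≡⟨ π-assoc (hyp k es⁺) ⟨
    π (flatten (hyp k es⁺))                                  ≡⟨ cong π (flattenAt-≡ k es⁺ T p) ⟩
    π (flattenAt k es⁺ T p)
      ≡⟨ π-iso (↭⇒Iso (flattenEdges-units us es out (nested n k T) _ (Agree-subst p _))) ⟩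
    π (hyp (k + T) (List.map (renE out) us ++ (marks (nested n k T) ++ FE)))
      ≡⟨ cong (λ xs → π (hyp (k + T) xs))
           (trans (sym (ListP.++-assoc (List.map (renE out) us) _ FE)) (cong (_++ FE) marks-≡)) ⟩
    π (hyp (k + T) (marks (n ↑ʳ_) ++ FE))                    ∎)
    where
    T   = innerSum es
    us  = marks (n ↑ʳ_)
    es⁺ = List.map (mapE unit) us ++ List.map (mapE mark) es
    p   = innerSum-units us es
    out = outer n k T
    FE  = flattenEdges es out (nested n k T)
    labels-≡ : List.map (mapE π) es⁺ ≡ us ++ List.map (mapE (λ H → π (mark H))) es
    labels-≡ = trans (ListP.map-++ (mapE π) (List.map (mapE unit) us) _) (cong₂ _++_
      (trans (sym (ListP.map-∘ us))
        (trans (ListP.map-cong (λ (edge a l v) → cong (λ l' → edge a l' v) (π-unit l)) us) (ListP.map-id us)))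
      (sym (ListP.map-∘ es)))
    marks-≡ : List.map (renE out) us ++ marks (nested n k T) ≡ marks (n ↑ʳ_)
    marks-≡ = sym (trans (tabulate-+ k _) (cong₂ _++_
      (trans (ListP.tabulate-cong (λ j → cong markEdge (sym (outer-inner n k T j))))
             (sym (ListP.map-tabulate _ (renE out))))
      (ListP.tabulate-cong (λ j → cong markEdge (sym (nested-inner n k T j))))))

  algebra : Alg
  algebra = record
    { C       = C
    ; finite  = finite
    ; π       = λ G → π (mark G)
    ; π-iso   = λ i → π-iso (mark-Iso i)
    -- A unit has no internal vertices, so marking it changes nothing.
    ; π-unit  = π-unit
    ; π-assoc = assoc
    }

-- Incidence

bool-ext : ∀ {b b'} → (b ≡ true → b' ≡ true) → (b' ≡ true → b ≡ true) → b ≡ b'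
bool-ext {true}  {b'}    f g = sym (f refl)
bool-ext {false} {false} f g = refl
bool-ext {false} {true}  f g = g refl

module Incidence where

  -- Two sets of pinned sources, and whether some internal vertex is pinned by both sets.
  C : Ranked
  C n = Vec Bool n × Vec Bool n × Bool

  pins : ∀ {n} → Bool → C n → Vec Bool n
  pins true  (p , q , b) = p
  pins false (p , q , b) = q

  bit : ∀ {n} → C n → Bool
  bit (p , q , b) = b

  Pinned : ∀ {V} → Bool → List (Edge C V) → Fin V → Set
  Pinned s es x = Any (λ e → ∃ λ j → Vec.lookup (inc e) j ≡ x × Vec.lookup (pins s (lab e)) j ≡ true) es

  pinned? : ∀ {V} s (es : List (Edge C V)) x → Dec (Pinned s es x)
  pinned? s es x = Any.any? (λ e → FinP.any? λ j →
    (Vec.lookup (inc e) j Fin.≟ x) ×-dec (Vec.lookup (pins s (lab e)) j Bool.≟ true)) es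

  Bit : ∀ {V} → List (Edge C V) → Set
  Bit es = Any (λ e → bit (lab e) ≡ true) es

  -- The family `emb` says which vertices count as internal: all of them in the product, only the
  -- nested ones in the induction over labels. Meetings at sources are left out, since both pins
  -- stay recorded there until the source becomes internal.
  Meeting : ∀ {k V} → List (Edge C V) → (Fin k → Fin V) → Set
  Meeting es emb = Bit es ⊎ ∃ λ j → Pinned true es (emb j) × Pinned false es (emb j)

  meeting? : ∀ {k V} (es : List (Edge C V)) (emb : Fin k → Fin V) → Dec (Meeting es emb)
  meeting? es emb = Any.any? (λ e → bit (lab e) Bool.≟ true) es
    ⊎-dec FinP.any? (λ j → pinned? true es (emb j) ×-dec pinned? false es (emb j))

  π : ∀ {n} → Hyp C n → C n
  π {n} (hyp k es) =
    Vec.tabulate (λ i → does (pinned? true es (i ↑ˡ k))) ,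
    Vec.tabulate (λ i → does (pinned? false es (i ↑ˡ k))) ,
    does (meeting? es (n ↑ʳ_))

  lookup-pins : ∀ {n} s (G : Hyp C n) i → Vec.lookup (pins s (π G)) i ≡ does (pinned? s (edges G) (i ↑ˡ inner G))
  lookup-pins true  G i = VecP.lookup∘tabulate _ i
  lookup-pins false G i = VecP.lookup∘tabulate _ i

  pins⁺ : ∀ {n} s (G : Hyp C n) i → Pinned s (edges G) (i ↑ˡ inner G) → Vec.lookup (pins s (π G)) i ≡ true
  pins⁺ s G i h = trans (lookup-pins s G i) (dec-true (pinned? s (edges G) _) h)

  pins⁻ : ∀ {n} s (G : Hyp C n) i → Vec.lookup (pins s (π G)) i ≡ true → Pinned s (edges G) (i ↑ˡ inner G)
  pins⁻ s G i h = does-true (pinned? s (edges G) _) (trans (sym (lookup-pins s G i)) h)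

  bit⁺ : ∀ {n} (G : Hyp C n) → Meeting (edges G) (n ↑ʳ_) → bit (π G) ≡ true
  bit⁺ {n} G = dec-true (meeting? (edges G) (n ↑ʳ_))

  bit⁻ : ∀ {n} (G : Hyp C n) → bit (π G) ≡ true → Meeting (edges G) (n ↑ʳ_)
  bit⁻ {n} G = does-true (meeting? (edges G) (n ↑ʳ_))

  -- Equality is split into two inclusions, so that the laws are proved by following pins and
  -- meetings in one direction at a time.
  record _≼_ {n : ℕ} (c d : C n) : Set where
    constructor _&_
    field
      pins-≼ : ∀ s i → Vec.lookup (pins s c) i ≡ true → Vec.lookup (pins s d) i ≡ true
      bit-≼  : bit c ≡ true → bit d ≡ true

  ≼-antisym : ∀ {n} {c d : C n} → c ≼ d → d ≼ c → c ≡ d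
  ≼-antisym {c = c} {d} (f & f') (g & g') = cong₂ _,_ (vec true) (cong₂ _,_ (vec false) (bool-ext f' g'))
    where
    vec : ∀ s → pins s c ≡ pins s d
    vec s = trans (sym (VecP.tabulate∘lookup _)) (trans
      (VecP.tabulate-cong (λ i → bool-ext (f s i) (g s i))) (VecP.tabulate∘lookup _))

  ren⁺ : ∀ {V W} s (f : Fin V → Fin W) {es x} → Pinned s es x → Pinned s (List.map (renE f) es) (f x)
  ren⁺ s f h = AnyP.map⁺ (Any.map
    (λ { {edge a l v} (j , eq , b) → j , trans (VecP.lookup-map j f v) (cong f eq) , b }) h)

  ren⁻ : ∀ {V W} s (f : Fin V → Fin W) es {y} → Pinned s (List.map (renE f) es) y → ∃ λ x → f x ≡ y × Pinned s es x
  ren⁻ s f (edge a l v ∷ es) (here (j , eq , b)) =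
    Vec.lookup v j , trans (sym (VecP.lookup-map j f v)) eq , here (j , refl , b)
  ren⁻ s f (e ∷ es) (there h) with ren⁻ s f es h
  ... | x , eq , h' = x , eq , there h'

  π-≼ : ∀ {n} {G G' : Hyp C n} → Iso G G' → π G ≼ π G'
  π-≼ {n} {G} {G'} i = (λ s j → pins⁺ s G' j ∘ subst (Pinned s _) (src j) ∘ transport s ∘ pins⁻ s G j) &
    (bit⁺ G' ∘ meet ∘ bit⁻ G)
    where
    open Iso i
    open Inverse bij
    transport : ∀ s {x} → Pinned s (edges G) x → Pinned s (edges G') (to x)
    transport s = PermP.Any-resp-↭ edg ∘ ren⁺ s to
    meet : Meeting (edges G) (n ↑ʳ_) → Meeting (edges G') (n ↑ʳ_)
    meet (inj₁ b) = inj₁ (PermP.Any-resp-↭ edg (AnyP.map⁺ b))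
    meet (inj₂ (j , p , q)) with Iso-inner i j
    ... | j' , eq = inj₂ (j' , subst (Pinned true _) eq (transport true p) ,
                                subst (Pinned false _) eq (transport false q))

  π-unit : ∀ {n} (a : C n) → π (unit a) ≡ a
  π-unit {n} a = ≼-antisym
    ((λ s i → to s i ∘ pins⁻ s (unit a) i) & (bit-to ∘ bit⁻ (unit a)))
    ((λ s i b → pins⁺ s (unit a) i (here (i , VecP.lookup∘tabulate _ i , b))) & (λ b → bit⁺ (unit a) (inj₁ (here b))))
    where
    to : ∀ s i → Pinned s (edges (unit a)) (i ↑ˡ 0) → Vec.lookup (pins s a) i ≡ true
    to s i (here (j , eq , b)) rewrite ↑ˡ-injective 0 _ _ (trans (sym (VecP.lookup∘tabulate (_↑ˡ 0) j)) eq) = b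
    bit-to : Meeting (edges (unit a)) (n ↑ʳ_) → bit a ≡ true
    bit-to (inj₁ (here b)) = b

  module _ {W V : ℕ} (out : Fin W → Fin V) where

    module _ {a k T} (v : Vec (Fin W) a) (emb : Fin (k + T) → Fin V) where

      ρ : Fin (a + k) → Fin V
      ρ = glue (out ∘ Vec.lookup v) (λ j → emb (j ↑ˡ T))

      ρ-source : ∀ i → ρ (i ↑ˡ k) ≡ out (Vec.lookup v i)
      ρ-source = glue-↑ˡ _ _

      ρ-inner : ∀ j → ρ (a ↑ʳ j) ≡ emb (j ↑ˡ T)
      ρ-inner = glue-↑ʳ (out ∘ Vec.lookup v) _

    -- Serves to exclude that hyperedges of later labels touch the nested vertices of the first one.
    pinned-range : ∀ s es (emb : Fin (innerSum es) → Fin V) {x} → Pinned s (flattenEdges es out emb) x →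
      (∃ λ w → out w ≡ x) ⊎ (∃ λ j → emb j ≡ x)
    pinned-range s (edge a (hyp k hs) v ∷ es) emb h
      with AnyP.++⁻ (List.map (renE (ρ v emb)) hs) h
    ... | inj₂ h' with pinned-range s es (emb ∘ (k ↑ʳ_)) h'
    ...   | inj₁ r        = inj₁ r
    ...   | inj₂ (j , eq) = inj₂ (k ↑ʳ j , eq)
    pinned-range s (edge a (hyp k hs) v ∷ es) emb h
        | inj₁ h' with ren⁻ s (ρ v emb) hs h'
    ...   | x , eq , _ with split a x
    ...     | left i  = inj₁ (_ , trans (sym (ρ-source v emb i)) eq)
    ...     | right j = inj₂ (_ , trans (sym (ρ-inner v emb j)) eq)

    pinned-out⁺ : ∀ s es (emb : Fin (innerSum es) → Fin V) {w} →
      Pinned s (List.map (mapE π) es) w → Pinned s (flattenEdges es out emb) (out w)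
    pinned-out⁺ s (edge a H v ∷ es) emb (here (i , refl , b)) =
      AnyP.++⁺ˡ (subst (Pinned s _) (ρ-source v emb i) (ren⁺ s (ρ v emb) (pins⁻ s H i b)))
    pinned-out⁺ s (edge a H v ∷ es) emb (there h) =
      AnyP.++⁺ʳ (List.map (renE _) (edges H)) (pinned-out⁺ s es _ h)

    module _ (out-injective : ∀ {x y} → out x ≡ out y → x ≡ y) where

      -- An outer vertex is not nested, so inside a label it can only be reached through a source,
      -- and injectivity of `out` identifies the vertex attached to that source.
      pinned-out⁻ : ∀ s es (emb : Fin (innerSum es) → Fin V) → (∀ w j → out w ≢ emb j) → ∀ {w} →
        Pinned s (flattenEdges es out emb) (out w) → Pinned s (List.map (mapE π) es) w
      pinned-out⁻ s (edge a H v ∷ es) emb out≢emb h with AnyP.++⁻ (List.map (renE (ρ v emb)) (edges H)) h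
      ... | inj₂ h' = there (pinned-out⁻ s es _ (λ w j → out≢emb w _) h')
      ... | inj₁ h' with ren⁻ s (ρ v emb) (edges H) h'
      ...   | x , eq , hx with split a x
      ...     | left i  = here (i , out-injective (trans (sym (ρ-source v emb i)) eq) , pins⁺ s H i hx)
      ...     | right j = contradiction (trans (sym eq) (ρ-inner v emb j)) (out≢emb _ _)

    meeting⁺ : ∀ es (emb : Fin (innerSum es) → Fin V) → Bit (List.map (mapE π) es) →
      Meeting (flattenEdges es out emb) emb
    meeting⁺ (edge a H v ∷ es) emb (here b) with bit⁻ H b
    ... | inj₁ b' = inj₁ (AnyP.++⁺ˡ (AnyP.map⁺ b'))
    ... | inj₂ (j , p , q) = inj₂ (j ↑ˡ _ , lift true p , lift false q)
      where
      lift : ∀ s → Pinned s (edges H) (a ↑ʳ j) → Pinned s (flattenEdges (edge a H v ∷ es) out emb) (emb (j ↑ˡ _))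
      lift s h = AnyP.++⁺ˡ (subst (Pinned s _) (ρ-inner v emb j) (ren⁺ s (ρ v emb) h))
    meeting⁺ (edge a H v ∷ es) emb (there b) with meeting⁺ es (emb ∘ (inner H ↑ʳ_)) b
    ... | inj₁ b' = inj₁ (AnyP.++⁺ʳ (List.map (renE _) (edges H)) b')
    ... | inj₂ (j , p , q) = inj₂ (inner H ↑ʳ j ,
      AnyP.++⁺ʳ (List.map (renE _) (edges H)) p , AnyP.++⁺ʳ (List.map (renE _) (edges H)) q)

    -- A nested vertex is touched only by hyperedges of the label it comes from. Two pins meeting
    -- there therefore lie in one label, whose own bit records the meeting.
    meeting⁻ : ∀ es (emb : Fin (innerSum es) → Fin V) → (∀ {i j} → emb i ≡ emb j → i ≡ j) →
      (∀ w j → out w ≢ emb j) → Meeting (flattenEdges es out emb) emb → Bit (List.map (mapE π) es)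
    meeting⁻ [] emb emb-inj out≢emb (inj₁ ())
    meeting⁻ [] emb emb-inj out≢emb (inj₂ (() , _))
    meeting⁻ (edge a H v ∷ es) emb emb-inj out≢emb (inj₁ b) with AnyP.++⁻ (List.map (renE (ρ v emb)) (edges H)) b
    ... | inj₁ b' = here (bit⁺ H (inj₁ (AnyP.map⁻ b')))
    ... | inj₂ b' = there (meeting⁻ es _ (↑ʳ-injective (inner H) _ _ ∘ emb-inj) (λ w j → out≢emb w _) (inj₁ b'))
    meeting⁻ (edge a H v ∷ es) emb emb-inj out≢emb (inj₂ (j , p , q)) with split (inner H) j
    ... | left j' = here (bit⁺ H (inj₂ (j' , in-head true p , in-head false q)))
      where
      in-head : ∀ s → Pinned s (flattenEdges (edge a H v ∷ es) out emb) (emb (j' ↑ˡ _)) →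
        Pinned s (edges H) (a ↑ʳ j')
      in-head s h with AnyP.++⁻ (List.map (renE (ρ v emb)) (edges H)) h
      ... | inj₂ h' with pinned-range s es _ h'
      ...   | inj₁ (w , eq)  = contradiction eq (out≢emb w _)
      ...   | inj₂ (j″ , eq) = contradiction (sym (emb-inj eq)) (↑ˡ≢↑ʳ j' j″)
      in-head s h | inj₁ h' with ren⁻ s (ρ v emb) (edges H) h'
      ...   | x , eq , hx with split a x
      ...     | left i   = contradiction (trans (sym (ρ-source v emb i)) eq) (out≢emb _ _)
      ...     | right j″ = subst (Pinned s _ ∘ (a ↑ʳ_))
                (↑ˡ-injective _ _ _ (emb-inj (trans (sym (ρ-inner v emb j″)) eq))) hx
    ... | right j' = there (meeting⁻ es _ (↑ʳ-injective (inner H) _ _ ∘ emb-inj) (λ w j → out≢emb w _)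
                       (inj₂ (j' , in-tail true p , in-tail false q)))
      where
      in-tail : ∀ s → Pinned s (flattenEdges (edge a H v ∷ es) out emb) (emb (inner H ↑ʳ j')) →
        Pinned s (flattenEdges es out (emb ∘ (inner H ↑ʳ_))) (emb (inner H ↑ʳ j'))
      in-tail s h with AnyP.++⁻ (List.map (renE (ρ v emb)) (edges H)) h
      ... | inj₂ h' = h'
      ... | inj₁ h' with ren⁻ s (ρ v emb) (edges H) h'
      ...   | x , eq , hx with split a x
      ...     | left i   = contradiction (trans (sym (ρ-source v emb i)) eq) (out≢emb _ _)
      ...     | right j″ = contradiction (emb-inj (trans (sym (ρ-inner v emb j″)) eq)) (↑ˡ≢↑ʳ j″ j')

  module _ {n} (G : Hyp (Hyp C) n) where
    private
      k  = inner G
      es = edges G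
      T  = innerSum es
      FE = edges (flatten G)

    flatten-≼ : π (flatten G) ≼ π (mapH π G)
    flatten-≼ =
      (λ s i h → pins⁺ s (mapH π G) i (from-out s
        (subst (Pinned s FE) (sym (outer-source n k T i)) (pins⁻ s (flatten G) i h))))
      & (bit⁺ (mapH π G) ∘ meet ∘ bit⁻ (flatten G))
      where
      from-out : ∀ s {w} → Pinned s FE (outer n k T w) → Pinned s (List.map (mapE π) es) w
      from-out s = pinned-out⁻ (outer n k T) (outer-injective n k T) s es (nested n k T) (outer≢nested n k T)
      nested-meet : Meeting FE (nested n k T) → Bit (List.map (mapE π) es)
      nested-meet = meeting⁻ (outer n k T) es (nested n k T) (nested-injective n k T) (outer≢nested n k T)
      meet : Meeting FE (n ↑ʳ_) → Meeting (List.map (mapE π) es) (n ↑ʳ_)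
      meet (inj₁ b) = inj₁ (nested-meet (inj₁ b))
      -- An internal vertex of the flattening is either internal in `G`, where its pins become pins
      -- of labels, or nested, where the meeting becomes the bit of a label.
      meet (inj₂ (j , p , q)) with split k j
      ... | left j'  = inj₂ (j' , get true p , get false q)
        where
        get : ∀ s → Pinned s FE (n ↑ʳ (j' ↑ˡ T)) → Pinned s (List.map (mapE π) es) (n ↑ʳ j')
        get s = from-out s ∘ subst (Pinned s FE) (sym (outer-inner n k T j'))
      ... | right j' = inj₁ (nested-meet (inj₂ (j' , get true p , get false q)))
        where
        get : ∀ s → Pinned s FE (n ↑ʳ (k ↑ʳ j')) → Pinned s FE (nested n k T j')
        get s = subst (Pinned s FE) (sym (nested-inner n k T j'))

    flatten-≽ : π (mapH π G) ≼ π (flatten G)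
    flatten-≽ =
      (λ s i h → pins⁺ s (flatten G) i (subst (Pinned s FE) (outer-source n k T i)
        (into-out s (pins⁻ s (mapH π G) i h))))
      & (bit⁺ (flatten G) ∘ meet ∘ bit⁻ (mapH π G))
      where
      into-out : ∀ s {w} → Pinned s (List.map (mapE π) es) w → Pinned s FE (outer n k T w)
      into-out s = pinned-out⁺ (outer n k T) s es (nested n k T)
      meet : Meeting (List.map (mapE π) es) (n ↑ʳ_) → Meeting FE (n ↑ʳ_)
      meet (inj₂ (j , p , q)) = inj₂ (j ↑ˡ T ,
        subst (Pinned true FE) (outer-inner n k T j) (into-out true p) ,
        subst (Pinned false FE) (outer-inner n k T j) (into-out false q))
      meet (inj₁ b) with meeting⁺ (outer n k T) es (nested n k T) b
      ... | inj₁ b' = inj₁ b'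
      ... | inj₂ (j , p , q) = inj₂ (k ↑ʳ j ,
        subst (Pinned true FE) (nested-inner n k T j) p , subst (Pinned false FE) (nested-inner n k T j) q)

  algebra : Alg
  algebra = record
    { C       = C
    ; finite  = λ n → finite-× (finite-Vec finite-Bool n) (finite-× (finite-Vec finite-Bool n) finite-Bool)
    ; π       = π
    ; π-iso   = λ i → ≼-antisym (π-≼ i) (π-≼ (Iso-sym i))
    ; π-unit  = π-unit
    ; π-assoc = λ G → ≼-antisym (flatten-≼ G) (flatten-≽ G)
    }

-- Recognisers

∧-true⁺ : ∀ {a b} → a ≡ true → b ≡ true → a ∧ b ≡ true
∧-true⁺ refl refl = refl

∧-true⁻ : ∀ a {b} → a ∧ b ≡ true → a ≡ true × b ≡ true
∧-true⁻ true eq = refl , eq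

count-cong : ∀ {N} {X Y : Fin N → Bool} → X ≗ Y → count X ≡ count Y
count-cong {zero}  X≗Y = refl
count-cong {suc N} X≗Y = cong₂ (λ b n → (if b then 1 else 0) + n) (X≗Y zero) (count-cong (X≗Y ∘ suc))

count-false : ∀ N → count {N} (λ _ → false) ≡ 0
count-false zero    = refl
count-false (suc N) = count-false N

count-singleton : ∀ {N} (x : Fin N) (Q : Fin N → Bool) →
  count (λ p → does (x Fin.≟ p) ∧ Q p) ≡ (if Q x then 1 else 0)
count-singleton {suc N} zero Q with Q zero
... | true  = cong suc (count-false N)
... | false = count-false N
count-singleton (suc x) Q = count-singleton x (Q ∘ suc)

count-none : ∀ {N} (X : Fin N → Bool) → count X ≡ 0 → ∀ p → X p ≡ false
count-none {suc N} X eq p with X zero in X₀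
count-none {suc N} X eq zero    | false = X₀
count-none {suc N} X eq (suc p) | false = count-none (X ∘ suc) eq p

count-one : ∀ {N} (X : Fin N → Bool) → count X ≡ 1 → ∃ λ x → ∀ p → X p ≡ does (x Fin.≟ p)
count-one {suc N} X eq with X zero in X₀
... | true  = zero , λ { zero → X₀ ; (suc p) → count-none (X ∘ suc) (suc-injective eq) p }
... | false with count-one (X ∘ suc) eq
...   | x , h = suc x , λ { zero → X₀ ; (suc p) → h p }

indicator-≡ᵇ-1 : ∀ b → ((if b then 1 else 0) ≡ᵇ 1) ≡ b
indicator-≡ᵇ-1 true  = refl
indicator-≡ᵇ-1 false = refl

anyFin⁺ : ∀ {N} (P : Fin N → Bool) x → P x ≡ true → anyFin P ≡ true
anyFin⁺ P zero    eq = cong (_∨ anyFin (P ∘ suc)) eq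
anyFin⁺ P (suc x) eq = trans (cong (P zero ∨_) (anyFin⁺ (P ∘ suc) x eq)) (∨-zeroʳ (P zero))

anyFin⁻ : ∀ {N} (P : Fin N → Bool) → anyFin P ≡ true → ∃ λ x → P x ≡ true
anyFin⁻ {suc N} P eq with P zero in P₀
... | true  = zero , P₀
... | false with anyFin⁻ (P ∘ suc) eq
...   | x , Px = suc x , Px

-- Sets are functions here, so a given one is found in the enumeration only up to pointwise
-- equality.
subsets-complete : ∀ {N} (X : Fin N → Bool) → Any (_≗ X) (subsets N)
subsets-complete {zero}  X = here λ ()
subsets-complete {suc N} X = AnyP.concatMap⁺ _ (Any.map extend (subsets-complete (X ∘ suc)))
  where
  extend : ∀ {Y} → Y ≗ X ∘ suc → Any (_≗ X) _
  extend Y≗X with X zero in X₀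
  ... | false = here λ { zero → sym X₀ ; (suc p) → Y≗X p }
  ... | true  = there (here λ { zero → sym X₀ ; (suc p) → Y≗X p })

anySubset⁺ : ∀ {N} (P : (Fin N → Bool) → Bool) → (∀ {X Y} → X ≗ Y → P X ≡ P Y) →
  ∀ X → P X ≡ true → any P (subsets N) ≡ true
anySubset⁺ P P-cong X eq = Equivalence.to T-≡
  (AnyP.any⁺ P (Any.map (λ Y≗X → Equivalence.from T-≡ (trans (P-cong Y≗X) eq)) (subsets-complete X)))

anySubset⁻ : ∀ {N} (P : (Fin N → Bool) → Bool) → any P (subsets N) ≡ true → ∃ λ X → P X ≡ true
anySubset⁻ {N} P eq with Any.satisfied (AnyP.any⁻ P (subsets N) (Equivalence.from T-≡ eq))
... | X , h = X , Equivalence.to T-≡ h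

incAt⁺ : ∀ {V a} (ws : Vec (Fin V) a) j → incAt (suc (toℕ j)) ws (Vec.lookup ws j) ≡ true
incAt⁺ (w ∷ ws) zero    = trans (isYes≗does (w Fin.≟ w)) (dec-true (w Fin.≟ w) refl)
incAt⁺ (w ∷ ws) (suc j) = incAt⁺ ws j

incAt⁻ : ∀ {V a} i (ws : Vec (Fin V) a) {v} → incAt i ws v ≡ true →
  ∃ λ j → suc (toℕ j) ≡ i × Vec.lookup ws j ≡ v
incAt⁻ (suc zero)    (w ∷ ws) eq = zero , refl , does-true (w Fin.≟ _) (trans (sym (isYes≗does (w Fin.≟ _))) eq)
incAt⁻ (suc (suc i)) (w ∷ ws) eq with incAt⁻ (suc i) ws eq
... | j , refl , eq' = suc j , refl , eq'

module _ {Σ' : FinRanked} where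

  -- The second summand labels the unary edges that mark vertices.
  Letter : Ranked
  Letter n = ⟦ Σ' ⟧ n ⊎ n ≡ 1

  module _ (G : Hyp ⟦ Σ' ⟧ 0) where

    -- One hyperedge per element of the universe, so that a colouring of the universe becomes a
    -- colouring of hyperedges.
    itemOf : Fin (V G) ⊎ Fin (E G) → Edge Letter (V G)
    itemOf (inj₁ v) = edge 1 (inj₂ refl) (v ∷ [])
    itemOf (inj₂ e) = mapE inj₁ (edgeAt G e)

    item : Fin (N G) → Edge Letter (V G)
    item x = itemOf (splitAt (V G) x)

  record Recogniser (K : Set) : Set₁ where
    field
      alg    : Alg
    open Alg alg public
    field
      letter : ∀ {n} → Letter n → K → C n
      accept : C 0 → Bool

    paint : ∀ {N V} → (Fin N → Edge Letter V) → (Fin N → K) → List (Edge C V)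
    paint it c = tabulate (λ x → mapE (λ l → letter l (c x)) (it x))

    -- The marks of vertices are written out as hyperedges, each with its own colour; `Marking`
    -- absorbs them only for sentences, where all colours are equal.
    run : (G : Hyp ⟦ Σ' ⟧ 0) → (Fin (N G) → K) → Bool
    run G c = accept (π (hyp (V G) (paint (item G) c)))

    run-cong : ∀ G {c c' : Fin (N G) → K} → c ≗ c' → run G c ≡ run G c'
    run-cong G c≗c' = cong (λ es → accept (π (hyp (V G) es)))
      (ListP.tabulate-cong (λ x → cong (λ κ → mapE (λ l → letter l κ) (item G x)) (c≗c' x)))

  open Recogniser using (run; run-cong)

  complement : ∀ {K} → Recogniser K → Recogniser K
  complement r = record { alg = alg ; letter = letter ; accept = not ∘ accept }
    where open Recogniser r

  module _ {K : Set} (r s : Recogniser K) where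
    private
      module R = Recogniser r
      module S = Recogniser s

    both : Recogniser K
    both = record
      { alg    = Product.algebra R.alg S.alg
      ; letter = λ l κ → R.letter l κ , S.letter l κ
      ; accept = λ (a , b) → R.accept a ∧ S.accept b
      }

    run-both : ∀ G c → run both G c ≡ run r G c ∧ run s G c
    run-both G c = cong₂ (λ es es' → R.accept (R.π (hyp (V G) es)) ∧ S.accept (S.π (hyp (V G) es')))
      (ListP.map-tabulate _ (mapE proj₁)) (ListP.map-tabulate _ (mapE proj₂))

  module _ {K : Set} (m k : ℕ) (test : ∀ {n} → Letter n → K → Bool) where
    private
      res = residues m k
      open Residues res
      module A = Counting res

    counting : Recogniser K
    counting = record
      { alg    = A.algebra
      ; letter = λ l κ → nf (if test l κ then 1 else 0)
      ; accept = λ a → modEq m (toℕ a) k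
      }

    run-counting : ∀ G c → run counting G c ≡ modEq m (count (λ x → test (lab (item G x)) (c x))) k
    run-counting G c = trans (cong (λ a → modEq m (toℕ a) k) (go (item G) c)) (nf-modEq _)
      where
      go : ∀ {N V} (it : Fin N → Edge Letter V) (c : Fin N → K) →
        nf (A.total (Recogniser.paint counting it c)) ≡ nf (count (λ x → test (lab (it x)) (c x)))
      go {zero}  it c = refl
      go {suc N} it c = trans (nf-+ _ _)
        (A.nf-+ʳ (if test (lab (it zero)) (c zero) then 1 else 0) (go (it ∘ suc) (c ∘ suc)))

  module _ {K K' : Set} (insert : Bool → K → K') (r : Recogniser K') where
    private
      module R = Recogniser r
      open Power R.alg

      pair : ∀ {n} → R.C n → R.C n → P n
      pair s t = ⁅ index s ⁆ ∪ ⁅ index t ⁆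

      ∋-pairˡ : ∀ {n} (s t : R.C n) → pair s t ∋ s
      ∋-pairˡ s t = x∈p∪q⁺ (inj₁ (x∈⁅x⁆ _))

      ∋-pairʳ : ∀ {n} (s t : R.C n) → pair s t ∋ t
      ∋-pairʳ s t = x∈p∪q⁺ {p = ⁅ index s ⁆} (inj₂ (x∈⁅x⁆ _))

      index-injective : ∀ {n} {s t : R.C n} → index s ≡ index t → s ≡ t
      index-injective eq = trans (sym (at-index _)) (trans (cong at eq) (at-index _))

      ∋-pair⁻ : ∀ {n} (s t : R.C n) {u} → pair s t ∋ u → u ≡ s ⊎ u ≡ t
      ∋-pair⁻ s t u∈ with x∈p∪q⁻ ⁅ index s ⁆ ⁅ index t ⁆ u∈
      ... | inj₁ h = inj₁ (index-injective (x∈⁅y⁆⇒x≡y _ h))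
      ... | inj₂ h = inj₂ (index-injective (x∈⁅y⁆⇒x≡y _ h))

      accepting? : (S : P 0) → Dec (∃ λ i → i ∈ₛ S × R.accept (at i) ≡ true)
      accepting? S = FinP.any? (λ i → (i ∈? S) ×-dec (R.accept (at i) Bool.≟ true))

    -- Each letter becomes the set of its two coloured versions, so a choice of one element per
    -- hyperedge is a choice of the quantified set.
    project : Recogniser K
    project = record
      { alg    = algebra
      ; letter = λ l κ → pair (R.letter l (insert false κ)) (R.letter l (insert true κ))
      ; accept = λ S → does (accepting? S)
      }

    private
      open Recogniser project using (paint)

      paint-chosen : ∀ {N V} (it : Fin N → Edge Letter V) c (X : Fin N → Bool) →
        Pointwise (ERel _∋_) (paint it c) (R.paint it (λ x → insert (X x) (c x)))
      paint-chosen {zero}  it c X = []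
      paint-chosen {suc N} it c X = rel (chosen (X zero)) ∷ paint-chosen (it ∘ suc) (c ∘ suc) (X ∘ suc)
        where
        chosen : ∀ b → pair _ _ ∋ R.letter (lab (it zero)) (insert b (c zero))
        chosen false = ∋-pairˡ _ _
        chosen true  = ∋-pairʳ _ _

      -- The bit is read off from which of the two letters was chosen; should they coincide, either
      -- bit serves.
      chosen-paint : ∀ {N V} (it : Fin N → Edge Letter V) c {xs} → Pointwise (ERel _∋_) (paint it c) xs →
        Σ[ X ∈ (Fin N → Bool) ] xs ≡ R.paint it (λ x → insert (X x) (c x))
      chosen-paint {zero}  it c [] = (λ ()) , refl
      chosen-paint {suc N} it c (rel u∈ ∷ ps) with chosen-paint (it ∘ suc) (c ∘ suc) ps | ∋-pair⁻ _ _ u∈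
      ... | X , refl | inj₁ refl = (λ { zero → false ; (suc x) → X x }) , refl
      ... | X , refl | inj₂ refl = (λ { zero → true  ; (suc x) → X x }) , refl

    run-project⁺ : ∀ G c (X : Fin (N G) → Bool) → run r G (λ x → insert (X x) (c x)) ≡ true →
      run project G c ≡ true
    run-project⁺ G c X eq = dec-true (accepting? _)
      (_ , ∋-π'⁺ (hrel (paint-chosen (item G) c X)) , trans (cong R.accept (at-index _)) eq)

    run-project⁻ : ∀ G c → run project G c ≡ true →
      Σ[ X ∈ (Fin (N G) → Bool) ] run r G (λ x → insert (X x) (c x)) ≡ true
    run-project⁻ G c eq
      with i , i∈ , acc ← does-true (accepting? _) eq
      with ∋-π'⁻ (hyp (V G) (paint (item G) c)) (subst (_∈ₛ _) (sym (index-at i)) i∈)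
    ... | _ , hrel ps , πX≡ with chosen-paint (item G) c ps
    ...   | X , refl = X , trans (cong R.accept πX≡) acc

  module _ {K : Set} (i : ℕ) (tx ty : K → Bool) where
    private
      module A = Incidence

    incidence : Recogniser K
    incidence = record
      { alg    = A.algebra
      ; letter = letter
      ; accept = A.bit
      }
      where
      letter : ∀ {n} → Letter n → K → A.C n
      -- Positions count from 1 and vector indices from 0, hence `suc`; for `i` = 0 nothing is
      -- pinned, in accordance with `incAt`.
      letter {n} (inj₁ _) κ = Vec.tabulate (λ j → tx κ ∧ (suc (toℕ j) ≡ᵇ i)) , Vec.replicate n false , false
      letter (inj₂ refl)  κ = false ∷ [] , ty κ ∷ [] , false

    open Recogniser incidence using (letter; paint)

    module _ (G : Hyp ⟦ Σ' ⟧ 0) where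
      private
        incOf : Fin (V G) ⊎ Fin (E G) → Fin (V G) ⊎ Fin (E G) → Bool
        incOf (inj₂ e) (inj₁ v) = incAt i (inc (edgeAt G e)) v
        incOf _        _        = false

        incRel-incOf : ∀ p q → incRel G i p q ≡ incOf (splitAt (V G) p) (splitAt (V G) q)
        incRel-incOf p q with splitAt (V G) p | splitAt (V G) q
        ... | inj₁ _ | inj₁ _ = refl
        ... | inj₁ _ | inj₂ _ = refl
        ... | inj₂ _ | inj₁ _ = refl
        ... | inj₂ _ | inj₂ _ = refl

        Pins : Bool → Fin (V G) ⊎ Fin (E G) → K → Fin (V G) → Set
        Pins b s κ v = ∃ λ j → Vec.lookup (inc (itemOf G s)) j ≡ v
                             × Vec.lookup (A.pins b (letter (lab (itemOf G s)) κ)) j ≡ true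

        pins-x⁻ : ∀ s κ v → Pins true s κ v → tx κ ≡ true × incOf s (inj₁ v) ≡ true
        pins-x⁻ (inj₁ w) κ v (zero , _ , ())
        pins-x⁻ (inj₂ e) κ _ (j , refl , h)
          with ∧-true⁻ (tx κ) (trans (sym (VecP.lookup∘tabulate _ j)) h)
        ... | h₁ , h₂ with ≡ᵇ⇒≡ (suc (toℕ j)) i (Equivalence.from T-≡ h₂)
        ...   | refl = h₁ , incAt⁺ (inc (edgeAt G e)) j

        pins-x⁺ : ∀ s κ v → tx κ ≡ true → incOf s (inj₁ v) ≡ true → Pins true s κ v
        pins-x⁺ (inj₂ e) κ v h₁ h₂ with incAt⁻ i (inc (edgeAt G e)) h₂
        ... | j , eq , eq' = j , eq' , trans (VecP.lookup∘tabulate _ j)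
                (∧-true⁺ h₁ (Equivalence.to T-≡ (≡⇒≡ᵇ (suc (toℕ j)) i eq)))

        -- Only marks pin for `y`, and a mark pins the very vertex on which it sits.
        pins-y⁻ : ∀ s κ v → Pins false s κ v → ty κ ≡ true × s ≡ inj₁ v
        pins-y⁻ (inj₁ w) κ v (zero , eq , h) = h , cong inj₁ eq
        pins-y⁻ (inj₂ e) κ v (j , _ , h) with trans (sym (VecP.lookup-replicate j false)) h
        ... | ()

        no-bits : ∀ s κ → A.bit (letter (lab (itemOf G s)) κ) ≢ true
        no-bits (inj₁ v) κ ()
        no-bits (inj₂ e) κ ()

      -- No letter has its bit set and all vertices of a nullary hypergraph are internal, so
      -- acceptance means that some vertex is pinned both by the `i`-th place of a hyperedge `p` and
      -- by its own mark `q`.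
      run-incidence⁻ : ∀ c → run incidence G c ≡ true →
        ∃ λ p → ∃ λ q → tx (c p) ≡ true × ty (c q) ≡ true × incRel G i p q ≡ true
      run-incidence⁻ c eq with A.bit⁻ (hyp (V G) (paint (item G) c)) eq
      ... | inj₁ b with AnyP.tabulate⁻ {f = λ x → mapE (λ l → letter l (c x)) (item G x)} b
      ...   | p , h = contradiction h (no-bits (splitAt (V G) p) (c p))
      run-incidence⁻ c eq | inj₂ (v , hx , hy)
        with AnyP.tabulate⁻ {f = λ x → mapE (λ l → letter l (c x)) (item G x)} hx
           | AnyP.tabulate⁻ {f = λ x → mapE (λ l → letter l (c x)) (item G x)} hy
      ... | p , hp | q , hq with pins-x⁻ (splitAt (V G) p) (c p) v hp | pins-y⁻ (splitAt (V G) q) (c q) v hq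
      ...   | tp , inc-p | tq , q≡v = p , q , tp , tq ,
              trans (incRel-incOf p q) (trans (cong (incOf (splitAt (V G) p)) q≡v) inc-p)

      run-incidence⁺ : ∀ c p q → tx (c p) ≡ true → ty (c q) ≡ true → incRel G i p q ≡ true →
        run incidence G c ≡ true
      run-incidence⁺ c p q tp tq h = meet (splitAt (V G) q) refl (trans (sym (incRel-incOf p q)) h)
        where
        meet : ∀ t → splitAt (V G) q ≡ t → incOf (splitAt (V G) p) t ≡ true → run incidence G c ≡ true
        meet (inj₁ v) eq h' = A.bit⁺ (hyp (V G) (paint (item G) c)) (inj₂ (v ,
          AnyP.tabulate⁺ p (pins-x⁺ (splitAt (V G) p) (c p) v tp h') ,
          AnyP.tabulate⁺ q (subst (λ s → Pins false s (c q) v) (sym eq) (zero , refl , tq))))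
        meet (inj₂ e) eq h' with splitAt (V G) p
        meet (inj₂ e) eq () | inj₁ _
        meet (inj₂ e) eq () | inj₂ _

  -- Translation of formulas

  -- The values at an element of the characteristic functions of all variables.
  Colour : ℕ → ℕ → Set
  Colour fo so = Vec Bool fo × Vec Bool so

  insert₁ : ∀ {fo so} → Bool → Colour fo so → Colour (suc fo) so
  insert₁ b (u , w) = b ∷ u , w

  insert₂ : ∀ {fo so} → Bool → Colour fo so → Colour fo (suc so)
  insert₂ b (u , w) = u , b ∷ w

  hasLabel : ∀ {n} → Fin (FinRanked.size Σ') → Letter n → Bool
  hasLabel a (inj₁ (b , _)) = ⌊ b Fin.≟ a ⌋
  hasLabel a (inj₂ _)       = false

  atVariable : ∀ {fo so} → Fin fo → (∀ {n} → Letter n → Colour fo so → Bool) →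
    ∀ {n} → Letter n → Colour fo so → Bool
  atVariable x test l κ = Vec.lookup (proj₁ κ) x ∧ test l κ

  inSet : ∀ {fo so} → Fin so → ∀ {n} → Letter n → Colour fo so → Bool
  inSet X l κ = Vec.lookup (proj₂ κ) X

  -- A first-order quantifier is projected like a set quantifier, so the guessed set must be checked
  -- to have one element; modulus 0 makes this an equality with 1.
  singleton : ∀ {fo so} → Recogniser (Colour (suc fo) so)
  singleton = counting 0 1 (λ _ κ → Vec.head (proj₁ κ))

  compile : ∀ {fo so} → Form Σ' fo so → Recogniser (Colour fo so)
  compile (lab? a x)    = counting 0 1 (atVariable x (λ l _ → hasLabel a l))
  compile (inc? i x y)  = incidence i (λ κ → Vec.lookup (proj₁ κ) x) (λ κ → Vec.lookup (proj₁ κ) y)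
  -- Counts the elements coloured by both variables: there is one exactly when the variables
  -- coincide.
  compile (eq? x y)     = counting 0 1 (atVariable y (λ _ κ → Vec.lookup (proj₁ κ) x))
  compile (mem? x X)    = counting 0 1 (atVariable x (inSet X))
  compile (card? X k m) = counting m k (inSet X)
  compile (¬' φ)        = complement (compile φ)
  compile (φ ∧' ψ)      = both (compile φ) (compile ψ)
  compile (∃₁ φ)        = project insert₁ (both (compile φ) singleton)
  compile (∃₂ φ)        = project insert₂ (compile φ)

  module _ (G : Hyp ⟦ Σ' ⟧ 0) where

    colour : ∀ {fo so} → (Fin fo → Fin (N G)) → (Fin so → Fin (N G) → Bool) → Fin (N G) → Colour fo so
    colour ρ σ p = Vec.tabulate (λ x → does (ρ x Fin.≟ p)) , Vec.tabulate (λ X → σ X p)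

    hasLabel-item : ∀ a p → hasLabel a (lab (item G p)) ≡ labAt G a p
    hasLabel-item a p with splitAt (V G) p
    ... | inj₁ _ = refl
    ... | inj₂ _ = refl

    -- The colour of `x` is present at the single element `ρ x`, so the count is 1 or 0 according to
    -- the test there.
    run-atVariable : ∀ {fo so} (ρ : Fin fo → Fin (N G)) (σ : Fin so → Fin (N G) → Bool) x
      (test : ∀ {n} → Letter n → Colour fo so → Bool) (Q : Fin (N G) → Bool) →
      (∀ p → test (lab (item G p)) (colour ρ σ p) ≡ Q p) →
      run (counting 0 1 (atVariable x test)) G (colour ρ σ) ≡ Q (ρ x)
    run-atVariable ρ σ x test Q test≡Q = begin
      run (counting 0 1 (atVariable x test)) G (colour ρ σ)
        ≡⟨ run-counting 0 1 (atVariable x test) G (colour ρ σ) ⟩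
      (count (λ p → atVariable x test (lab (item G p)) (colour ρ σ p)) ≡ᵇ 1)
        ≡⟨ cong (_≡ᵇ 1) (count-cong (λ p → cong₂ _∧_ (VecP.lookup∘tabulate _ x) (test≡Q p))) ⟩
      (count (λ p → does (ρ x Fin.≟ p) ∧ Q p) ≡ᵇ 1)
        ≡⟨ cong (_≡ᵇ 1) (count-singleton (ρ x) Q) ⟩
      ((if Q (ρ x) then 1 else 0) ≡ᵇ 1)
        ≡⟨ indicator-≡ᵇ-1 (Q (ρ x)) ⟩
      Q (ρ x)  ∎

    Correct : ∀ {fo so} → Form Σ' fo so → Set
    Correct φ = ∀ ρ σ → run (compile φ) G (colour ρ σ) ≡ eval G φ ρ σ

    module _ {fo so} (φ : Form Σ' (suc fo) so) (correct : Correct φ)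
             (σ : Fin so → Fin (N G) → Bool) where
      private
        painted : (Fin fo → Fin (N G)) → (Fin (N G) → Bool) → Fin (N G) → Colour (suc fo) so
        painted ρ X p = insert₁ (X p) (colour ρ σ p)

      run-matrix : ∀ ρ X → run (both (compile φ) singleton) G (painted ρ X) ≡
        run (compile φ) G (painted ρ X) ∧ (count X ≡ᵇ 1)
      run-matrix ρ X = trans (run-both (compile φ) singleton G (painted ρ X))
        (cong (run (compile φ) G (painted ρ X) ∧_) (run-counting 0 1 (λ _ κ → Vec.head (proj₁ κ)) G (painted ρ X)))

      -- The guessed set agrees with the singleton only pointwise, which `run-cong` absorbs; then
      -- the painting computes to the colour of the extended valuation.
      run-painted : ∀ ρ X → (∀ p → X p ≡ does (ρ zero Fin.≟ p)) →
        run (compile φ) G (painted (ρ ∘ suc) X) ≡ eval G φ ρ σ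
      run-painted ρ X X≗x = trans
        (run-cong (compile φ) G (λ p → cong (λ b → insert₁ b (colour (ρ ∘ suc) σ p)) (X≗x p)))
        (correct ρ σ)

      ∃₁⁻ : ∀ ρ → run (compile (∃₁ φ)) G (colour ρ σ) ≡ true → eval G (∃₁ φ) ρ σ ≡ true
      -- A with-abstraction would normalise the algebra of φ, which is infeasible; likewise below.
      ∃₁⁻ ρ h =
        let X , hX   = run-project⁻ insert₁ (both (compile φ) singleton) G (colour ρ σ) h
            hφ , h₁  = ∧-true⁻ (run (compile φ) G (painted ρ X)) (trans (sym (run-matrix ρ X)) hX)
            x , X≗x  = count-one X (≡ᵇ⇒≡ (count X) 1 (Equivalence.from T-≡ h₁))
        in anyFin⁺ _ x (trans (sym (run-painted _ X X≗x)) hφ)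

      ∃₁⁺ : ∀ ρ → eval G (∃₁ φ) ρ σ ≡ true → run (compile (∃₁ φ)) G (colour ρ σ) ≡ true
      ∃₁⁺ ρ h =
        let x , hx = anyFin⁻ _ h
            X : Fin (N G) → Bool
            X p = does (x Fin.≟ p)
            count-X : count X ≡ 1
            count-X = trans (count-cong (λ p → sym (BoolP.∧-identityʳ (X p)))) (count-singleton x (λ _ → true))
        in run-project⁺ insert₁ (both (compile φ) singleton) G (colour ρ σ) X
             (trans (run-matrix ρ X) (∧-true⁺ (trans (run-painted _ X (λ _ → refl)) hx) (cong (_≡ᵇ 1) count-X)))

    module _ {fo so} (φ : Form Σ' fo (suc so)) (correct : Correct φ) (ρ : Fin fo → Fin (N G)) where
      private
        painted : (Fin so → Fin (N G) → Bool) → (Fin (N G) → Bool) → Fin (N G) → Colour fo (suc so)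
        painted σ X p = insert₂ (X p) (colour ρ σ p)

      -- `Vec.tabulate` puts the bit of `σ zero` first, so the two colourings agree by computation.
      -- Quantifying over the whole of `σ` lets it be instantiated with the extended valuation
      -- occurring in `eval`.
      run-painted₂ : ∀ σ → run (compile φ) G (painted (σ ∘ suc) (σ zero)) ≡ eval G φ ρ σ
      run-painted₂ σ = correct ρ σ

      ∃₂⁻ : ∀ σ → run (compile (∃₂ φ)) G (colour ρ σ) ≡ true → eval G (∃₂ φ) ρ σ ≡ true
      ∃₂⁻ σ h =
        let X , hX = run-project⁻ insert₂ (compile φ) G (colour ρ σ) h
        in anySubset⁺ _
          -- The listed copy of `X` is only pointwise equal to it, so `eval` must respect that
          -- equality; it does because it coincides with `run`.
          (λ {Y} {Z} Y≗Z → trans (sym (run-painted₂ _)) (trans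
            (run-cong (compile φ) G (λ p → cong (λ b → insert₂ b (colour ρ σ p)) (Y≗Z p)))
            (run-painted₂ _)))
          X (trans (sym (run-painted₂ _)) hX)

      ∃₂⁺ : ∀ σ → eval G (∃₂ φ) ρ σ ≡ true → run (compile (∃₂ φ)) G (colour ρ σ) ≡ true
      ∃₂⁺ σ h =
        let X , hX = anySubset⁻ _ h
        in run-project⁺ insert₂ (compile φ) G (colour ρ σ) X (trans (run-painted₂ _) hX)

    compile-correct : ∀ {fo so} (φ : Form Σ' fo so) → Correct φ
    compile-correct (lab? a x) ρ σ = run-atVariable ρ σ x (λ l _ → hasLabel a l) (labAt G a) (hasLabel-item a)
    compile-correct (inc? i x y) ρ σ = bool-ext to from
      where
      to : run (compile (inc? i x y)) G (colour ρ σ) ≡ true → incRel G i (ρ x) (ρ y) ≡ true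
      to h with run-incidence⁻ i _ _ G (colour ρ σ) h
      ... | p , q , hp , hq , hpq
        with does-true (ρ x Fin.≟ p) (trans (sym (VecP.lookup∘tabulate _ x)) hp)
           | does-true (ρ y Fin.≟ q) (trans (sym (VecP.lookup∘tabulate _ y)) hq)
      ... | refl | refl = hpq
      at-self : ∀ z → Vec.lookup (proj₁ (colour ρ σ (ρ z))) z ≡ true
      at-self z = trans (VecP.lookup∘tabulate _ z) (dec-true (ρ z Fin.≟ ρ z) refl)
      from : incRel G i (ρ x) (ρ y) ≡ true → run (compile (inc? i x y)) G (colour ρ σ) ≡ true
      from = run-incidence⁺ i _ _ G (colour ρ σ) (ρ x) (ρ y) (at-self x) (at-self y)
    compile-correct (eq? x y) ρ σ = trans
      (run-atVariable ρ σ y (λ _ κ → Vec.lookup (proj₁ κ) x) (λ p → does (ρ x Fin.≟ p))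
        (λ p → VecP.lookup∘tabulate _ x))
      (sym (isYes≗does (ρ x Fin.≟ ρ y)))
    compile-correct (mem? x X) ρ σ =
      run-atVariable ρ σ x (inSet X) (σ X) (λ p → VecP.lookup∘tabulate (λ Y → σ Y p) X)
    compile-correct (card? X k m) ρ σ = trans (run-counting m k (inSet X) G (colour ρ σ))
      (cong (λ c → modEq m c k) (count-cong (λ p → VecP.lookup∘tabulate (λ Y → σ Y p) X)))
    compile-correct (¬' φ) ρ σ = cong not (compile-correct φ ρ σ)
    compile-correct (φ ∧' ψ) ρ σ = trans (run-both (compile φ) (compile ψ) G _)
      (cong₂ _∧_ (compile-correct φ ρ σ) (compile-correct ψ ρ σ))
    compile-correct (∃₁ φ) ρ σ = bool-ext (∃₁⁻ φ (compile-correct φ) σ ρ) (∃₁⁺ φ (compile-correct φ) σ ρ)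
    compile-correct (∃₂ φ) ρ σ = bool-ext (∃₂⁻ φ (compile-correct φ) ρ σ) (∃₂⁺ φ (compile-correct φ) ρ σ)

-- Replacing finite carriers by `Fin`

module Transport (A : Alg) where
  open Alg A

  size : ℕ → ℕ
  size n = proj₁ (finite n)

  to : ∀ {n} → C n → Fin (size n)
  to {n} = Inverse.to (proj₂ (finite n))

  from : ∀ {n} → Fin (size n) → C n
  from {n} = Inverse.from (proj₂ (finite n))

  to-from : ∀ {n} (i : Fin (size n)) → to {n} (from i) ≡ i
  to-from {n} = Inverse.strictlyInverseˡ (proj₂ (finite n))

  from-to : ∀ {n} (a : C n) → from (to a) ≡ a
  from-to {n} = Inverse.strictlyInverseʳ (proj₂ (finite n))

  -- Taking `from` for `f` yields associativity of the transported product; taking a map of letters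
  -- yields multiplicativity of the homomorphism.
  π-hom : ∀ {R : Ranked} (f : ∀ {n} → R n → C n) {n} (G : Hyp (Hyp R) n) →
    π (mapH f (flatten G)) ≡ π (mapH from (mapH (λ H → to (π (mapH f H))) G))
  π-hom f G = begin
    π (mapH f (flatten G))                             ≡⟨ cong π (flatten-natural f G) ⟩
    π (flatten (mapH (mapH f) G))                      ≡⟨ π-assoc _ ⟩
    π (mapH π (mapH (mapH f) G))                       ≡⟨ cong π (mapH-∘ π (mapH f) G) ⟨
    π (mapH (λ H → π (mapH f H)) G)                    ≡⟨ cong π (mapH-cong (λ H → sym (from-to (π (mapH f H)))) G) ⟩
    π (mapH (λ H → from (to (π (mapH f H)))) G)        ≡⟨ cong π (mapH-∘ from (λ H → to (π (mapH f H))) G) ⟩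
    π (mapH from (mapH (λ H → to (π (mapH f H))) G))   ∎

  algebra : CompFinHAlgebra
  algebra = record
    { size    = size
    ; π       = λ G → to (π (mapH from G))
    ; π-iso   = λ _ _ _ _ i → cong to (π-iso (mapH-Iso from i))
    ; π-unit  = λ a → trans (cong to (π-unit (from a))) (to-from a)
    ; π-assoc = λ G _ → cong to (π-hom from G)
    }

  hom : ∀ {Σ'} → (∀ {n} → ⟦ Σ' ⟧ n → C n) → Hom Σ' algebra
  hom f = record
    { h      = λ G → to (π (mapH f G))
    ; h-iso  = λ _ _ _ _ i → cong to (π-iso (mapH-Iso f i))
    ; h-mult = λ G _ → cong to (π-hom f G)
    }

-- The recognising homomorphism of a sentence

theorem4p26 : (Σ' : FinRanked) (L : Hyp ⟦ Σ' ⟧ 0 → Set) →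
    CMSO₂-definable Σ' L →
    Σ[ A ∈ CompFinHAlgebra ] Σ[ φ ∈ Hom Σ' A ] Recognises φ L
theorem4p26 Σ' L (φ , L⇔φ) = algebra , hom (λ l → letter (inj₁ l) none) , λ G G' wf wf' h≡ LG →
  proj₂ (L⇔φ G' wf') (begin
    eval G' φ (λ ()) (λ ())                       ≡⟨ accept-π⁺ G' ⟨
    accept (π⁺ (mapH (λ l → letter (inj₁ l) none) G'))
      -- Equal images under `to` come from equal products, since `from` undoes `to`.
      ≡⟨ cong accept (trans (sym (from-to _)) (trans (cong from h≡) (from-to _))) ⟨
    accept (π⁺ (mapH (λ l → letter (inj₁ l) none) G))
                                                  ≡⟨ accept-π⁺ G ⟩
    eval G φ (λ ()) (λ ())                        ≡⟨ proj₁ (L⇔φ G wf) LG ⟩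
    true                                          ∎)
  where
  open Recogniser (compile φ)

  none : Colour {Σ'} 0 0
  none = [] , []

  open Marking alg (letter (inj₂ refl) none) using (markEdge; marks; mark) renaming (algebra to alg⁺)
  open Transport alg⁺
  open Alg alg⁺ using () renaming (π to π⁺)

  -- Marks precede hyperedges in `mark` as vertices precede hyperedges in the universe, so the two
  -- hypergraphs are equal and not merely isomorphic.
  mark-paint : ∀ G → mark (mapH (λ l → letter (inj₁ l) none) G) ≡ hyp (V G) (paint (item G) (λ _ → none))
  mark-paint G@(hyp k es) = cong (hyp k) (sym (trans (tabulate-+ k _) (cong₂ _++_
    (ListP.tabulate-cong (λ v → cong (mapE (λ l → letter l none) ∘ itemOf G) (splitAt-↑ˡ k v (length es))))
    (trans (ListP.tabulate-cong (λ e → cong (mapE (λ l → letter l none) ∘ itemOf G) (splitAt-↑ʳ k (length es) e)))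
    (trans (sym (ListP.map-tabulate (List.lookup es) (mapE (λ l → letter (inj₁ l) none))))
           (cong (List.map _) (ListP.tabulate-lookup es)))))))

  accept-π⁺ : ∀ G → accept (π⁺ (mapH (λ l → letter (inj₁ l) none) G)) ≡ eval G φ (λ ()) (λ ())
  accept-π⁺ G = trans (cong (accept ∘ π) (mark-paint G)) (compile-correct G φ (λ ()) (λ ()))
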